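{- There is a universal constant $\mu>1$ and a family $(G_n:n\in\mathbb{N})$ of quasi-line graphs of maximum degree at most $8$, with $|V(G_n)|=18n$, such that the mixing time of Glauber dynamics for the Ising model $(G_n,\mu)$ is $\Omega(2^n)$.
   Context: Graphs are finite and simple. For a graph $G$ and $\sigma:V(G)\to\{+,-\}$, let $\mathrm{cut}\,\sigma=\{\{u,v\}\in E(G):\sigma(u)\ne\sigma(v)\}$ and $\mathrm{wt}\,\sigma=\mu^{|\mathrm{cut}\,\sigma|}$; the Gibbs distribution of the Ising instance $(G,\mu)$ assigns probability $\mathrm{wt}\,\sigma/Z(G,\mu)$ to $\sigma$, where $Z(G,\mu)=\sum_{\sigma}\mathrm{wt}\,\sigma$. Glauber dynamics is the Markov chain on $\{+,-\}^{V(G)}$ which, from state $X_t=\sigma$, picks $v\in V(G)$ uniformly at random, lets $\sigma'$ agree with $\sigma$ except $\sigma'(v)=-\sigma(v)$, and sets $X_{t+1}=\sigma'$ with probability $\mathrm{wt}\,\sigma'/(\mathrm{wt}\,\sigma+\mathrm{wt}\,\sigma')$ and $X_{t+1}=\sigma$ otherwise. The mixing time is the maximum over starting states $\omega$ of the least $t$ such that the law of $X_t$ given $X_0=\omega$ is within total variation distance $\tfrac14$ of the Gibbs distribution. A graph is quasi-line if for every vertex $v$ the neighbours of $v$ can be partitioned into two sets each inducing a clique. -}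

module Defs where

open import Data.Bool using (Bool; true; false; if_then_else_; _∧_; _xor_; T)
open import Data.Nat as ℕ using (ℕ; zero; suc)
open import Data.Integer using (+_)
open import Data.Fin using (Fin; toℕ; zero; suc)
open import Data.Fin.Properties using (_≟_)
open import Data.List using (List; []; _∷_; map; foldr; _++_; allFin; length; filter)
open import Data.Rational as ℚ using (ℚ; 0ℚ; 1ℚ; ½; _+_; _*_; _-_; ∣_∣; _÷_; _/_; ≢-nonZero)
import Data.Rational.Properties as ℚP
open import Data.Product using (Σ; _×_; _,_)
open import Relation.Binary.PropositionalEquality using (_≡_; _≢_)
open import Relation.Nullary using (yes; no; does; ¬_)

record Graph (n : ℕ) : Set where
  field
    adj      : Fin n → Fin n → Bool
    adj-sym  : ∀ u v → adj u v ≡ adj v u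
    adj-irr  : ∀ v → adj v v ≡ false
open Graph public

degree : ∀ {n} → Graph n → Fin n → ℕ
degree G v = length (filter (λ u → T? (adj G v u)) (allFin _))
  where
  open import Data.Bool.Properties using (T?)

MaxDegreeAtMost : ∀ {n} → Graph n → ℕ → Set
MaxDegreeAtMost G d = ∀ v → degree G v ℕ.≤ d

IsClique : ∀ {n} → Graph n → (Fin n → Bool) → Set
IsClique G S = ∀ u w → S u ≡ true → S w ≡ true → u ≢ w → adj G u w ≡ true

-- Quasi-line: for each v, N(v) is partitioned into two sets A, B each
-- inducing a clique.  A partition of N(v) into two parts is given by a
-- colouring c : Fin n → Bool; A = N(v) ∩ c⁻¹(true), B = N(v) ∩ c⁻¹(false).
QuasiLine : ∀ {n} → Graph n → Set
QuasiLine {n} G = ∀ v → Σ (Fin n → Bool) λ c →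
    IsClique G (λ u → adj G v u ∧ c u)
  × IsClique G (λ u → adj G v u ∧ Data.Bool.not (c u))
  where import Data.Bool

-- true = '+', false = '-'
Spin : ℕ → Set
Spin n = Fin n → Bool

sumℕ : List ℕ → ℕ
sumℕ = foldr ℕ._+_ 0

sumℚ : List ℚ → ℚ
sumℚ = foldr _+_ 0ℚ

cutSize : ∀ {n} → Graph n → Spin n → ℕ
cutSize {n} G σ =
  sumℕ (map (λ u → sumℕ (map (λ v →
    if does (toℕ u ℕ.<? toℕ v) ∧ adj G u v ∧ (σ u xor σ v) then 1 else 0)
    (allFin n))) (allFin n))

_^ℚ_ : ℚ → ℕ → ℚ
x ^ℚ zero  = 1ℚ
x ^ℚ suc k = x * (x ^ℚ k)

wt : ∀ {n} → Graph n → ℚ → Spin n → ℚ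
wt G μ σ = μ ^ℚ cutSize G σ

-- total division (x / 0 := 0); only ever applied to positive
-- denominators when μ > 0.
_÷₀_ : ℚ → ℚ → ℚ
x ÷₀ y with y ℚP.≟ 0ℚ
... | yes _  = 0ℚ
... | no y≢0 = _÷_ x y {{≢-nonZero y≢0}}

allSpins : (n : ℕ) → List (Spin n)
allSpins zero    = (λ ()) ∷ []
allSpins (suc n) =
  map (λ σ → λ { zero → true  ; (suc i) → σ i }) (allSpins n) ++
  map (λ σ → λ { zero → false ; (suc i) → σ i }) (allSpins n)

_≡ˢ_ : ∀ {n} → Spin n → Spin n → Bool
_≡ˢ_ {n} σ τ = foldr _∧_ true (map (λ i → eqB (σ i) (τ i)) (allFin n))
  where
  eqB : Bool → Bool → Bool
  eqB true true = true
  eqB false false = true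
  eqB _ _ = false

Z : ∀ {n} → Graph n → ℚ → ℚ
Z {n} G μ = sumℚ (map (wt G μ) (allSpins n))

gibbs : ∀ {n} → Graph n → ℚ → Spin n → ℚ
gibbs G μ σ = wt G μ σ ÷₀ Z G μ

flip : ∀ {n} → Spin n → Fin n → Spin n
flip σ v u with does (u ≟ v)
... | true  = Data.Bool.not (σ u)
  where import Data.Bool
... | false = σ u

-- 1 / n  (as a rational; n ≥ 1 whenever a vertex exists)
uniform : ℕ → ℚ
uniform zero    = 0ℚ
uniform (suc k) = + 1 / suc k

transition : ∀ {n} → Graph n → ℚ → Spin n → Spin n → ℚ
transition {n} G μ σ τ = sumℚ (map term (allFin n))
  where
  term : Fin n → ℚ
  term v =
    let σ' = flip σ v
        p  = wt G μ σ' ÷₀ (wt G μ σ + wt G μ σ')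
    in uniform n * ((if τ ≡ˢ σ' then p else 0ℚ)
                   + (if τ ≡ˢ σ then 1ℚ - p else 0ℚ))

law : ∀ {n} → Graph n → ℚ → Spin n → ℕ → Spin n → ℚ
law G μ ω zero    τ = if τ ≡ˢ ω then 1ℚ else 0ℚ
law {n} G μ ω (suc t) τ =
  sumℚ (map (λ σ → law G μ ω t σ * transition G μ σ τ) (allSpins n))

dTV : ∀ {n} → (Spin n → ℚ) → (Spin n → ℚ) → ℚ
dTV {n} ν π = ½ * sumℚ (map (λ σ → ∣ ν σ - π σ ∣) (allSpins n))

quarter : ℚ
quarter = + 1 / 4

-- "the mixing time of Glauber dynamics for (G, μ) is at least T":
-- there is a starting state ω such that every t with
-- d_TV(law(X_t | X_0 = ω), Gibbs) ≤ 1/4 satisfies t ≥ T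
-- (i.e. the least such t, hence the maximum over ω, is ≥ T).
MixingTimeAtLeast : ∀ {n} → Graph n → ℚ → ℕ → Set
MixingTimeAtLeast {n} G μ T = Σ (Spin n) λ ω →
  ∀ t → dTV (law G μ ω t) (gibbs G μ) ℚ.≤ quarter → T ℕ.≤ t

{-# OPTIONS --safe #-}
module Submission where

-- The graph consists of n periods. A period is an edge ⊠ a path on four vertices, which has exactly two
-- maximum cuts, exchanged by the global spin flip; hence a period carries one spin at almost no cost.
-- Its two end pairs are simplicial, so they can receive one further edge per vertex: one edge links
-- consecutive periods, and one belongs to a partial matching of the periods. The matching is chosen
-- greedily so that every configuration with about n/2 up spins violates Ω(n) links (total weight of all
-- configurations as a potential). For large μ the set of such configurations therefore has weight
-- 2^(-n-2) relative to a ground state. Started from a ground state ω, the law of the chain stays below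
-- wt / wt ω by stationarity, so at each step at most this much mass leaks into the half of the state
-- space opposite to ω, which by symmetry has Gibbs measure at least 1/2.

open import Defs
open import Data.Nat using (ℕ; _*_; _≤_; _^_)
open import Data.Integer using (+_)
open import Data.Rational as ℚ using (ℚ; 0ℚ; 1ℚ; _/_)
open import Data.Product using (Σ; _×_)

open import Algebra.Structures using (IsSemiring; IsRing)
open import Data.Bool using (Bool; true; false; not; _∧_; _∨_; _xor_; if_then_else_; T)
import Data.Bool.Properties as BoolP
open import Data.Fin using (Fin; zero; suc; toℕ; #_; combine; remQuot; _↑ˡ_; _↑ʳ_)
open import Data.Fin.Properties using (_≟_; toℕ-injective; combine-remQuot; remQuot-combine)
import Data.Integer as ℤ
import Data.Integer.Properties as ℤP
open import Data.Integer.Solver using () renaming (module +-*-Solver to ℤ-Solver)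
open import Data.List using (List; []; _∷_; _++_; map; foldr; filter; length; take; allFin)
import Data.List.Properties as ListP
open import Data.List.Membership.Propositional using (_∈_)
open import Data.List.Membership.Propositional.Properties using (∈-allFin)
open import Data.List.Relation.Unary.Any using (here; there)
open import Data.Nat as ℕ
  using (zero; suc; _+_; _<_; z≤n; s≤s; ⌊_/2⌋; ∣_-_∣; _≤?_; _<?_; _≡ᵇ_; _<ᵇ_; _≤ᵇ_)
open import Data.Nat.DivMod using (m≡m%n+[m/n]*n; m%n<n; /-monoˡ-≤)
import Data.Nat.Properties as ℕP
open import Data.Nat.Tactic.RingSolver using (solve-∀)
open import Data.Product using (_,_; proj₁; proj₂)
open import Data.Rational using (½)
import Data.Rational.Properties as ℚP
open import Data.Rational.Solver using (module +-*-Solver)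
open import Data.Rational.Unnormalised as ℚᵘ using (mkℚᵘ)
import Data.Rational.Unnormalised.Properties as ℚᵘP
open import Data.Sum using (_⊎_; inj₁; inj₂)
open import Data.Unit using (tt)
open import Data.Vec as Vec using (Vec; []; _∷_)
open import Function using (_∘_)
open import Relation.Binary.Definitions using (tri<; tri≈; tri>)
open import Relation.Binary.PropositionalEquality
open import Relation.Nullary using (¬_; does; yes; no; contradiction)
open import Relation.Nullary.Decidable using (dec-true; dec-false)

open import Algebra.Properties.Monoid.Mult ℚP.+-0-monoid
  using () renaming (_×_ to _×ℚ_; ×-homo-+ to ×ℚ-homo-+)

-- Finite sums

-- The two end pairs of a period are an odd number of steps apart, so they carry opposite spins in a
-- maximum cut. Every link joins an end pair `{6,7}` to an end pair `{0,1}`, so between periods in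
-- maximum cuts it is cut exactly when their spins agree. Although `μ > 1` rewards cut edges, the
-- periods thus interact ferromagnetically, and no choice of links creates frustration. The path
-- alone, and likewise the matching alone, consists of paths and cycles, which can be halved by
-- violating at most two links; only their union can expand. The path also tames the entropy: with
-- weight 256 for a satisfied link and 1 for a violated one, all configurations together weigh only
-- `(257/256)^m` times as much as the two constant ones. This is why matching about an eighth of the
-- periods suffices. A period outside its maximum cuts loses as little as one cut edge but can hide
-- three violated links, so a violated link is worth only a third of a cut edge. Hence the cube in
-- `μ`; its large exponent pays for all `2^(18n)` states at once.

infix 4 _≗ˢ_

_≗ˢ_ : ∀ {n} → Spin n → Spin n → Set
σ ≗ˢ τ = ∀ i → σ i ≡ τ i

-- Functions on spins are only compared pointwise, so reindexing a sum over allSpins needs this.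
Extensional : ∀ {n} {A : Set} → (Spin n → A) → Set
Extensional f = ∀ {σ τ} → σ ≗ˢ τ → f σ ≡ f τ

infixr 5 _▸_

_▸_ : ∀ {n} → Bool → Spin n → Spin (suc n)
(b ▸ σ) zero    = b
(b ▸ σ) (suc i) = σ i

▸-cong : ∀ {n} b {σ τ : Spin n} → σ ≗ˢ τ → (b ▸ σ) ≗ˢ (b ▸ τ)
▸-cong b e zero    = refl
▸-cong b e (suc i) = e i

-- Cut sizes and auxiliary weights live in `ℕ`, probabilities in `ℚ`; both need the same reindexing
-- laws. `∑` unfolds to the same `foldr` and `map` as `sumℕ` and `sumℚ`, so the laws apply to the
-- given definitions directly.
module ListSum
  {A : Set} {_⊕_ _⊗_ : A → A → A} {0# 1# : A}
  (isSemiring : IsSemiring _≡_ _⊕_ _⊗_ 0# 1#)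
  {_⊑_ : A → A → Set} (⊑-refl : ∀ {x} → x ⊑ x)
  (⊕-mono : ∀ {w x y z} → w ⊑ x → y ⊑ z → (w ⊕ y) ⊑ (x ⊕ z))
  where

  open IsSemiring isSemiring
    using (+-identityˡ; +-identityʳ; +-assoc; +-comm; distribˡ; distribʳ; zeroˡ; zeroʳ)

  ∑ : {X : Set} → List X → (X → A) → A
  ∑ xs f = foldr _⊕_ 0# (map f xs)

  private variable
    X Y : Set

  ∑-cong : ∀ (xs : List X) {f g : X → A} → (∀ x → f x ≡ g x) → ∑ xs f ≡ ∑ xs g
  ∑-cong []       e = refl
  ∑-cong (x ∷ xs) e = cong₂ _⊕_ (e x) (∑-cong xs e)

  ∑-mono : ∀ (xs : List X) {f g : X → A} → (∀ x → f x ⊑ g x) → ∑ xs f ⊑ ∑ xs g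
  ∑-mono []       e = ⊑-refl
  ∑-mono (x ∷ xs) e = ⊕-mono (e x) (∑-mono xs e)

  ∑-zero : ∀ (xs : List X) → ∑ xs (λ _ → 0#) ≡ 0#
  ∑-zero []       = refl
  ∑-zero (x ∷ xs) = trans (+-identityˡ _) (∑-zero xs)

  +-interchange : ∀ a b c d → (a ⊕ b) ⊕ (c ⊕ d) ≡ (a ⊕ c) ⊕ (b ⊕ d)
  +-interchange a b c d = begin
    (a ⊕ b) ⊕ (c ⊕ d) ≡⟨ +-assoc a b _ ⟩
    a ⊕ (b ⊕ (c ⊕ d)) ≡⟨ cong (a ⊕_) (sym (+-assoc b c d)) ⟩
    a ⊕ ((b ⊕ c) ⊕ d) ≡⟨ cong (λ z → a ⊕ (z ⊕ d)) (+-comm b c) ⟩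
    a ⊕ ((c ⊕ b) ⊕ d) ≡⟨ cong (a ⊕_) (+-assoc c b d) ⟩
    a ⊕ (c ⊕ (b ⊕ d)) ≡⟨ sym (+-assoc a c _) ⟩
    (a ⊕ c) ⊕ (b ⊕ d) ∎
    where open ≡-Reasoning

  ∑-+ : ∀ (xs : List X) (f g : X → A) → ∑ xs (λ x → f x ⊕ g x) ≡ ∑ xs f ⊕ ∑ xs g
  ∑-+ []       f g = sym (+-identityˡ 0#)
  ∑-+ (x ∷ xs) f g =
    trans (cong ((f x ⊕ g x) ⊕_) (∑-+ xs f g)) (+-interchange (f x) (g x) _ _)

  ∑-*ˡ : ∀ (xs : List X) c (f : X → A) → ∑ xs (λ x → c ⊗ f x) ≡ c ⊗ ∑ xs f
  ∑-*ˡ []       c f = sym (zeroʳ c)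
  ∑-*ˡ (x ∷ xs) c f = trans (cong ((c ⊗ f x) ⊕_) (∑-*ˡ xs c f)) (sym (distribˡ c _ _))

  ∑-*ʳ : ∀ (xs : List X) c (f : X → A) → ∑ xs (λ x → f x ⊗ c) ≡ ∑ xs f ⊗ c
  ∑-*ʳ []       c f = sym (zeroˡ c)
  ∑-*ʳ (x ∷ xs) c f = trans (cong ((f x ⊗ c) ⊕_) (∑-*ʳ xs c f)) (sym (distribʳ c _ _))

  ∑-swap : ∀ (xs : List X) (ys : List Y) (f : X → Y → A) →
    ∑ xs (λ x → ∑ ys (f x)) ≡ ∑ ys (λ y → ∑ xs (λ x → f x y))
  ∑-swap []       ys f = sym (∑-zero ys)
  ∑-swap (x ∷ xs) ys f =
    trans (cong (∑ ys (f x) ⊕_) (∑-swap xs ys f)) (sym (∑-+ ys _ _))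

  ∑-++ : ∀ (xs ys : List X) (f : X → A) → ∑ (xs ++ ys) f ≡ ∑ xs f ⊕ ∑ ys f
  ∑-++ []       ys f = sym (+-identityˡ _)
  ∑-++ (x ∷ xs) ys f = trans (cong (f x ⊕_) (∑-++ xs ys f)) (sym (+-assoc (f x) _ _))

  ∑-map : ∀ (h : X → Y) (xs : List X) (f : Y → A) → ∑ (map h xs) f ≡ ∑ xs (f ∘ h)
  ∑-map h []       f = refl
  ∑-map h (x ∷ xs) f = cong (f (h x) ⊕_) (∑-map h xs f)

  ∑-fin-suc : ∀ {n} (f : Fin (suc n) → A) →
    ∑ (allFin (suc n)) f ≡ f zero ⊕ ∑ (allFin n) (f ∘ suc)
  ∑-fin-suc {n} f = cong (f zero ⊕_)
    (cong (foldr _⊕_ 0#) (trans (ListP.map-tabulate suc f) (sym (ListP.map-tabulate (λ i → i) (f ∘ suc)))))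

  ∑-fin-+ : ∀ m n (f : Fin (m ℕ.+ n) → A) →
    ∑ (allFin (m ℕ.+ n)) f ≡ ∑ (allFin m) (λ i → f (i ↑ˡ n)) ⊕ ∑ (allFin n) (λ i → f (m ↑ʳ i))
  ∑-fin-+ zero    n f = sym (+-identityˡ _)
  ∑-fin-+ (suc m) n f = begin
    ∑ (allFin (suc m ℕ.+ n)) f
      ≡⟨ ∑-fin-suc f ⟩
    f zero ⊕ ∑ (allFin (m ℕ.+ n)) (f ∘ suc)
      ≡⟨ cong (f zero ⊕_) (∑-fin-+ m n (f ∘ suc)) ⟩
    f zero ⊕ (∑ (allFin m) (λ i → f (suc i ↑ˡ n)) ⊕ ∑ (allFin n) (λ i → f (suc m ↑ʳ i)))
      ≡⟨ sym (+-assoc (f zero) _ _) ⟩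
    (f zero ⊕ ∑ (allFin m) (λ i → f (suc i ↑ˡ n))) ⊕ ∑ (allFin n) (λ i → f (suc m ↑ʳ i))
      ≡⟨ cong (_⊕ ∑ (allFin n) (λ i → f (suc m ↑ʳ i))) (sym (∑-fin-suc (λ i → f (i ↑ˡ n)))) ⟩
    ∑ (allFin (suc m)) (λ i → f (i ↑ˡ n)) ⊕ ∑ (allFin n) (λ i → f (suc m ↑ʳ i)) ∎
    where open ≡-Reasoning

  ∑-combine : ∀ m n (f : Fin (m * n) → A) →
    ∑ (allFin (m * n)) f ≡ ∑ (allFin m) (λ a → ∑ (allFin n) (λ i → f (combine a i)))
  ∑-combine zero    n f = refl
  ∑-combine (suc m) n f = begin
    ∑ (allFin (n ℕ.+ m * n)) f
      ≡⟨ ∑-fin-+ n (m * n) f ⟩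
    ∑ (allFin n) (λ i → f (i ↑ˡ (m * n))) ⊕ ∑ (allFin (m * n)) (λ u → f (n ↑ʳ u))
      ≡⟨ cong (∑ (allFin n) (λ i → f (i ↑ˡ (m * n))) ⊕_) (∑-combine m n (λ u → f (n ↑ʳ u))) ⟩
    ∑ (allFin n) (λ i → f (i ↑ˡ (m * n)))
      ⊕ ∑ (allFin m) (λ a → ∑ (allFin n) (λ i → f (n ↑ʳ combine a i)))
      ≡⟨ sym (∑-fin-suc {m} (λ a → ∑ (allFin n) (λ i → f (combine a i)))) ⟩
    ∑ (allFin (suc m)) (λ a → ∑ (allFin n) (λ i → f (combine a i))) ∎
    where open ≡-Reasoning

  ∑-fin-δ : ∀ {n} (i : Fin n) (f : Fin n → A) →
    ∑ (allFin n) (λ j → if does (i ≟ j) then f j else 0#) ≡ f i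
  ∑-fin-δ {suc n} zero f =
    trans (∑-fin-suc {n} _) (trans (cong (f zero ⊕_) (∑-zero (allFin n))) (+-identityʳ _))
  ∑-fin-δ {suc n} (suc i) f =
    trans (∑-fin-suc {n} _) (trans (+-identityˡ _) (∑-fin-δ i (f ∘ suc)))

  ∑-spins-suc : ∀ {n} {f : Spin (suc n) → A} → Extensional f →
    ∑ (allSpins (suc n)) f
      ≡ ∑ (allSpins n) (λ σ → f (true ▸ σ)) ⊕ ∑ (allSpins n) (λ σ → f (false ▸ σ))
  ∑-spins-suc {n} {f} f-ext = trans (∑-++ (map _ (allSpins n)) (map _ (allSpins n)) f)
    (cong₂ _⊕_
      (trans (∑-map _ (allSpins n) f)
        (∑-cong (allSpins n) λ σ → f-ext λ { zero → refl ; (suc i) → refl }))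
      (trans (∑-map _ (allSpins n) f)
        (∑-cong (allSpins n) λ σ → f-ext λ { zero → refl ; (suc i) → refl })))

  ∑-spins-not : ∀ {n} {f : Spin n → A} → Extensional f →
    ∑ (allSpins n) (λ σ → f (not ∘ σ)) ≡ ∑ (allSpins n) f
  ∑-spins-not {zero}  f-ext = cong (_⊕ 0#) (f-ext λ ())
  ∑-spins-not {suc n} {f} f-ext = begin
    ∑ (allSpins (suc n)) (λ σ → f (not ∘ σ))
      ≡⟨ ∑-spins-suc (λ e → f-ext (cong not ∘ e)) ⟩
    ∑ (allSpins n) (λ σ → f (not ∘ (true ▸ σ))) ⊕ ∑ (allSpins n) (λ σ → f (not ∘ (false ▸ σ)))
      ≡⟨ cong₂ _⊕_ (half true) (half false) ⟩
    ∑ (allSpins n) (λ σ → f (false ▸ σ)) ⊕ ∑ (allSpins n) (λ σ → f (true ▸ σ))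
      ≡⟨ +-comm _ _ ⟩
    ∑ (allSpins n) (λ σ → f (true ▸ σ)) ⊕ ∑ (allSpins n) (λ σ → f (false ▸ σ))
      ≡⟨ sym (∑-spins-suc f-ext) ⟩
    ∑ (allSpins (suc n)) f ∎
    where
    open ≡-Reasoning
    half : ∀ b → ∑ (allSpins n) (λ σ → f (not ∘ (b ▸ σ))) ≡ ∑ (allSpins n) (λ σ → f (not b ▸ σ))
    half b = trans (∑-cong (allSpins n) λ σ → f-ext λ { zero → refl ; (suc i) → refl })
                   (∑-spins-not (λ e → f-ext (▸-cong (not b) e)))

  -- The point mass is an arbitrary test `P`, sound and complete for pointwise equality with `τ`,
  -- because `transition` also yields tests such as `τ ≡ˢ flip σ v` in which the summation variable
  -- is `σ`.
  ∑-spins-δ : ∀ {n} (P : Spin n → Bool) {f : Spin n → A} (τ : Spin n) → Extensional f →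
    (∀ σ → P σ ≡ true → σ ≗ˢ τ) → (∀ σ → σ ≗ˢ τ → P σ ≡ true) →
    ∑ (allSpins n) (λ σ → if P σ then f σ else 0#) ≡ f τ
  ∑-spins-δ {zero} P {f} τ f-ext sound complete = trans (+-identityʳ _)
    (trans (cong (λ b → if b then f _ else 0#) (complete _ λ ())) (f-ext λ ()))
  ∑-spins-δ {suc n} P {f} τ f-ext sound complete =
    trans (∑-spins-suc ext') (cases (τ zero) refl)
    where
    P-ext : Extensional P
    P-ext {σ} {σ'} e with P σ in p | P σ' in p'
    ... | true  | true  = refl
    ... | false | false = refl
    ... | true  | false = trans (sym (complete σ' λ i → trans (sym (e i)) (sound σ p i))) p'
    ... | false | true  = trans (sym p) (complete σ λ i → trans (e i) (sound σ' p' i))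
    ext' : Extensional (λ σ → if P σ then f σ else 0#)
    ext' e = cong₂ (λ b x → if b then x else 0#) (P-ext e) (f-ext e)
    same : ∀ b → τ zero ≡ b → ∑ (allSpins n) (λ σ → if P (b ▸ σ) then f (b ▸ σ) else 0#) ≡ f τ
    same b e = trans
      (∑-spins-δ (λ σ → P (b ▸ σ)) (λ i → τ (suc i)) (λ e' → f-ext (▸-cong b e'))
        (λ σ p i → sound (b ▸ σ) p (suc i))
        (λ σ e' → complete (b ▸ σ) λ { zero → sym e ; (suc i) → e' i }))
      (f-ext λ { zero → sym e ; (suc i) → refl })
    other : ∀ b → τ zero ≡ not b → ∑ (allSpins n) (λ σ → if P (b ▸ σ) then f (b ▸ σ) else 0#) ≡ 0#
    other b e = trans (∑-cong (allSpins n) no-match) (∑-zero (allSpins n))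
      where
      clash : ∀ b → b ≢ not b
      clash true  ()
      clash false ()
      no-match : ∀ σ → (if P (b ▸ σ) then f (b ▸ σ) else 0#) ≡ 0#
      no-match σ with P (b ▸ σ) in p
      ... | false = refl
      ... | true  = contradiction (trans (sound (b ▸ σ) p zero) e) (clash b)
    cases : ∀ b → τ zero ≡ b → _ ≡ f τ
    cases true  e = trans (cong₂ _⊕_ (same true e) (other false e)) (+-identityʳ _)
    cases false e = trans (cong₂ _⊕_ (other true e) (same false e)) (+-identityˡ _)

module ΣN = ListSum ℕP.+-*-isSemiring {ℕ._≤_} ℕP.≤-refl ℕP.+-mono-≤
module ΣQ = ListSum (IsRing.isSemiring ℚP.+-*-isRing) {ℚ._≤_} ℚP.≤-refl ℚP.+-mono-≤

-- Spins and rational arithmetic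

∧-fold-sound : ∀ {X : Set} (xs : List X) (g : X → Bool) →
  foldr _∧_ true (map g xs) ≡ true → ∀ {x} → x ∈ xs → g x ≡ true
∧-fold-sound (x ∷ xs) g p with g x in e
∧-fold-sound (x ∷ xs) g p | true = λ { (here refl) → e ; (there x∈) → ∧-fold-sound xs g p x∈ }

∧-fold-false : ∀ {X : Set} (xs : List X) (g : X → Bool) →
  foldr _∧_ true (map g xs) ≡ false → Σ X λ x → g x ≡ false
∧-fold-false (x ∷ xs) g p with g x in e
... | false = x , e
... | true  = ∧-fold-false xs g p

≡ˢ-sound : ∀ {n} (σ τ : Spin n) → (σ ≡ˢ τ) ≡ true → σ ≗ˢ τ
≡ˢ-sound σ τ p i with σ i | τ i | ∧-fold-sound (allFin _) _ p (∈-allFin i)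
... | true  | true  | _ = refl
... | false | false | _ = refl

≡ˢ-complete : ∀ {n} (σ τ : Spin n) → σ ≗ˢ τ → (σ ≡ˢ τ) ≡ true
≡ˢ-complete σ τ e with σ ≡ˢ τ in p
... | true  = refl
... | false with ∧-fold-false (allFin _) _ p
...   | i , q with σ i | τ i | e i | q
...     | true  | .true  | refl | ()
...     | false | .false | refl | ()

flip-cong : ∀ {n} {σ τ : Spin n} (v : Fin n) → σ ≗ˢ τ → flip σ v ≗ˢ flip τ v
flip-cong v e u with does (u ≟ v)
... | true  = cong not (e u)
... | false = e u

flip-flip : ∀ {n} (σ : Spin n) (v : Fin n) → flip (flip σ v) v ≗ˢ σ
flip-flip σ v u with does (u ≟ v) in e
... | false rewrite e = refl
... | true  rewrite e with σ u
...   | true  = refl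
...   | false = refl

cutSize-ext : ∀ {n} (G : Graph n) → Extensional (cutSize G)
cutSize-ext {n} G e = ΣN.∑-cong (allFin n) λ u → ΣN.∑-cong (allFin n) λ v →
  cong₂ (λ a b → if does (toℕ u ℕ.<? toℕ v) ∧ adj G u v ∧ (a xor b) then 1 else 0) (e u) (e v)

cutSize-not : ∀ {n} (G : Graph n) σ → cutSize G (not ∘ σ) ≡ cutSize G σ
cutSize-not {n} G σ = ΣN.∑-cong (allFin n) λ u → ΣN.∑-cong (allFin n) λ v →
  cong (λ x → if does (toℕ u ℕ.<? toℕ v) ∧ adj G u v ∧ x then 1 else 0) (xor-not (σ u) (σ v))
  where
  xor-not : ∀ a b → not a xor not b ≡ a xor b
  xor-not true  true  = refl
  xor-not true  false = refl
  xor-not false true  = refl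
  xor-not false false = refl

÷₀-*-cancel : ∀ x {y} → 0ℚ ℚ.< y → (x ÷₀ y) ℚ.* y ≡ x
÷₀-*-cancel x {y} 0<y with y ℚP.≟ 0ℚ
... | yes refl = contradiction 0<y (ℚP.<-irrefl refl)
... | no  y≢0  = begin
  (x ℚ.* 1/y) ℚ.* y ≡⟨ ℚP.*-assoc x 1/y y ⟩
  x ℚ.* (1/y ℚ.* y) ≡⟨ cong (x ℚ.*_) (ℚP.*-inverseˡ y) ⟩
  x ℚ.* 1ℚ          ≡⟨ ℚP.*-identityʳ x ⟩
  x                 ∎
  where
  open ≡-Reasoning
  instance _ = ℚ.≢-nonZero y≢0
  1/y = ℚ.1/ y

*-mono-≤-nonNeg : ∀ {a b} x → 0ℚ ℚ.≤ x → a ℚ.≤ b → a ℚ.* x ℚ.≤ b ℚ.* x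
*-mono-≤-nonNeg x 0≤x a≤b = ℚP.*-monoʳ-≤-nonNeg x {{ℚ.nonNegative 0≤x}} a≤b

*-cancel-≤-pos : ∀ {a b} x → 0ℚ ℚ.< x → a ℚ.* x ℚ.≤ b ℚ.* x → a ℚ.≤ b
*-cancel-≤-pos x 0<x = ℚP.*-cancelʳ-≤-pos x {{ℚ.positive 0<x}}

*-nonNeg : ∀ {a b} → 0ℚ ℚ.≤ a → 0ℚ ℚ.≤ b → 0ℚ ℚ.≤ a ℚ.* b
*-nonNeg {a} {b} 0≤a 0≤b = subst (ℚ._≤ a ℚ.* b) (ℚP.*-zeroˡ b) (*-mono-≤-nonNeg b 0≤b 0≤a)

*-pos : ∀ {a b} → 0ℚ ℚ.< a → 0ℚ ℚ.< b → 0ℚ ℚ.< a ℚ.* b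
*-pos {a} {b} 0<a 0<b =
  subst (ℚ._< a ℚ.* b) (ℚP.*-zeroˡ b) (ℚP.*-monoˡ-<-pos b {{ℚ.positive 0<b}} 0<a)

≤-0+ : ∀ {a b} → 0ℚ ℚ.≤ b → a ℚ.≤ a ℚ.+ b
≤-0+ {a} {b} 0≤b = subst (ℚ._≤ a ℚ.+ b) (ℚP.+-identityʳ a) (ℚP.+-monoʳ-≤ a 0≤b)

+-nonNeg : ∀ {a b} → 0ℚ ℚ.≤ a → 0ℚ ℚ.≤ b → 0ℚ ℚ.≤ a ℚ.+ b
+-nonNeg 0≤a 0≤b = ℚP.≤-trans 0≤a (≤-0+ 0≤b)

÷₀-nonNeg : ∀ {x y} → 0ℚ ℚ.≤ x → 0ℚ ℚ.< y → 0ℚ ℚ.≤ x ÷₀ y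
÷₀-nonNeg {x} {y} 0≤x 0<y = *-cancel-≤-pos y 0<y
  (subst₂ ℚ._≤_ (sym (ℚP.*-zeroˡ y)) (sym (÷₀-*-cancel x 0<y)) 0≤x)

÷₀-≤-1 : ∀ {x y} → x ℚ.≤ y → 0ℚ ℚ.< y → x ÷₀ y ℚ.≤ 1ℚ
÷₀-≤-1 {x} {y} x≤y 0<y = *-cancel-≤-pos y 0<y
  (subst₂ ℚ._≤_ (sym (÷₀-*-cancel x 0<y)) (sym (ℚP.*-identityˡ y)) x≤y)

≤⇒0≤- : ∀ {a b} → a ℚ.≤ b → 0ℚ ℚ.≤ b ℚ.- a
≤⇒0≤- {a} {b} a≤b = subst (ℚ._≤ b ℚ.- a) (ℚP.+-inverseʳ a) (ℚP.+-monoˡ-≤ (ℚ.- a) a≤b)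

^ℚ-pos : ∀ {x} → 0ℚ ℚ.< x → ∀ k → 0ℚ ℚ.< x ^ℚ k
^ℚ-pos 0<x zero    = ℚP.positive⁻¹ 1ℚ
^ℚ-pos 0<x (suc k) = *-pos 0<x (^ℚ-pos 0<x k)

∑-fin-const : ∀ n x → ΣQ.∑ (allFin n) (λ _ → x) ≡ n ×ℚ x
∑-fin-const zero    x = refl
∑-fin-const (suc n) x = trans (ΣQ.∑-fin-suc {n} (λ _ → x)) (cong (x ℚ.+_) (∑-fin-const n x))

-- Unnormalised rationals keep the denominator `suc k` fixed, so that the induction on `j` meets no
-- gcd.
×-uniform : ∀ k j → ℚ.toℚᵘ (j ×ℚ uniform (suc k)) ℚᵘ.≃ mkℚᵘ (+ j) k
×-uniform k zero    = ℚᵘ.*≡* refl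
×-uniform k (suc j) = begin
  ℚ.toℚᵘ (u ℚ.+ j ×ℚ u)              ≈⟨ ℚP.toℚᵘ-homo-+ u (j ×ℚ u) ⟩
  ℚ.toℚᵘ u ℚᵘ.+ ℚ.toℚᵘ (j ×ℚ u)      ≈⟨ ℚᵘP.+-cong (ℚP.toℚᵘ-fromℚᵘ (mkℚᵘ (+ 1) k)) (×-uniform k j) ⟩
  mkℚᵘ (+ 1) k ℚᵘ.+ mkℚᵘ (+ j) k     ≈⟨ ℚᵘ.*≡* (cross (+ j) (+ suc k)) ⟩
  mkℚᵘ (+ suc j) k                   ∎
  where
  u = uniform (suc k)
  open ℚᵘP.≃-Reasoning
  cross : ∀ a d → (+ 1 ℤ.* d ℤ.+ a ℤ.* d) ℤ.* d ≡ (+ 1 ℤ.+ a) ℤ.* (d ℤ.* d)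
  cross = solve 2 (λ a d → (con (+ 1) :* d :+ a :* d) :* d := (con (+ 1) :+ a) :* (d :* d)) refl
    where open ℤ-Solver

∑-uniform : ∀ k → ΣQ.∑ (allFin (suc k)) (λ _ → uniform (suc k)) ≡ 1ℚ
∑-uniform k = trans (∑-fin-const (suc k) (uniform (suc k))) (ℚP.toℚᵘ-injective
  (ℚᵘP.≃-trans (×-uniform k (suc k)) (ℚᵘ.*≡* (ℤP.*-comm (+ suc k) (+ 1)))))

-- Escape from a bottleneck

-- Turns division into multiplication by one fixed number, after which the ring solver and the
-- linearity of sums apply.
÷₀≡*1÷₀ : ∀ x y → x ÷₀ y ≡ x ℚ.* (1ℚ ÷₀ y)
÷₀≡*1÷₀ x y with y ℚP.≟ 0ℚ
... | yes _   = sym (ℚP.*-zeroʳ x)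
... | no  y≢0 = cong (x ℚ.*_) (sym (ℚP.*-identityˡ _))

p≤∣p∣ : ∀ p → p ℚ.≤ ℚ.∣ p ∣
p≤∣p∣ p with ℚP.≤-total 0ℚ p
... | inj₁ 0≤p = ℚP.≤-reflexive (sym (ℚP.0≤p⇒∣p∣≡p 0≤p))
... | inj₂ p≤0 = ℚP.≤-trans p≤0 (ℚP.0≤∣p∣ p)

-p≤∣p∣ : ∀ p → ℚ.- p ℚ.≤ ℚ.∣ p ∣
-p≤∣p∣ p = subst (ℚ.- p ℚ.≤_) (ℚP.∣-p∣≡∣p∣ p) (p≤∣p∣ (ℚ.- p))

∑-nonNeg : ∀ {X : Set} (xs : List X) {f : X → ℚ} → (∀ x → 0ℚ ℚ.≤ f x) → 0ℚ ℚ.≤ ΣQ.∑ xs f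
∑-nonNeg xs {f} 0≤f = subst (ℚ._≤ ΣQ.∑ xs f) (ΣQ.∑-zero xs) (ΣQ.∑-mono xs 0≤f)

if-nonNeg : ∀ b {x} → 0ℚ ℚ.≤ x → 0ℚ ℚ.≤ (if b then x else 0ℚ)
if-nonNeg true  0≤x = 0≤x
if-nonNeg false 0≤x = ℚP.≤-refl

1≤x+x⇒½≤x : ∀ {x} → 1ℚ ℚ.≤ x ℚ.+ x → ½ ℚ.≤ x
1≤x+x⇒½≤x {x} 1≤ = subst₂ ℚ._≤_ refl (halve x) (ℚP.*-monoˡ-≤-nonNeg ½ 1≤)
  where
  open +-*-Solver
  halve : ∀ x → ½ ℚ.* (x ℚ.+ x) ≡ x
  halve = solve 1 (λ x → con ½ :* (x :+ x) := x) refl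

module Glauber {k} (G : Graph (suc k)) {μ : ℚ} (0<μ : 0ℚ ℚ.< μ) where

  open ΣQ

  private
    N = suc k
    S = allSpins N
    vs = allFin N
    u = uniform N
    w = wt G μ
    P = transition G μ

  w-pos : ∀ σ → 0ℚ ℚ.< w σ
  w-pos σ = ^ℚ-pos 0<μ (cutSize G σ)

  w-nonNeg : ∀ σ → 0ℚ ℚ.≤ w σ
  w-nonNeg σ = ℚP.<⇒≤ (w-pos σ)

  w-ext : Extensional w
  w-ext e = cong (μ ^ℚ_) (cutSize-ext G e)

  u-nonNeg : 0ℚ ℚ.≤ u
  u-nonNeg = ℚP.nonNegative⁻¹ u {{ℚP.normalize-nonNeg 1 N}}

  accept : Spin N → Fin N → ℚ
  accept σ v = w (flip σ v) ÷₀ (w σ ℚ.+ w (flip σ v))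

  accept-ext : ∀ v → Extensional (λ σ → accept σ v)
  accept-ext v e = cong₂ (λ a b → b ÷₀ (a ℚ.+ b)) (w-ext e) (w-ext (flip-cong v e))

  w+w-pos : ∀ σ v → 0ℚ ℚ.< w σ ℚ.+ w (flip σ v)
  w+w-pos σ v = ℚP.<-≤-trans (w-pos σ) (≤-0+ (w-nonNeg (flip σ v)))

  accept-nonNeg : ∀ σ v → 0ℚ ℚ.≤ accept σ v
  accept-nonNeg σ v = ÷₀-nonNeg (w-nonNeg (flip σ v)) (w+w-pos σ v)

  accept-≤-1 : ∀ σ v → accept σ v ℚ.≤ 1ℚ
  accept-≤-1 σ v = ÷₀-≤-1
    (subst (w (flip σ v) ℚ.≤_) (ℚP.+-comm (w (flip σ v)) (w σ)) (≤-0+ (w-nonNeg σ)))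
    (w+w-pos σ v)

  P-nonNeg : ∀ σ τ → 0ℚ ℚ.≤ P σ τ
  P-nonNeg σ τ = ∑-nonNeg vs λ v → *-nonNeg u-nonNeg (+-nonNeg
    (if-nonNeg (τ ≡ˢ flip σ v) (accept-nonNeg σ v))
    (if-nonNeg (τ ≡ˢ σ) (≤⇒0≤- (accept-≤-1 σ v))))

  ∑-u-const : ∀ x → ∑ vs (λ _ → u ℚ.* x) ≡ x
  ∑-u-const x = trans (∑-*ʳ vs x (λ _ → u)) (trans (cong (ℚ._* x) (∑-uniform k)) (ℚP.*-identityˡ x))

  if-*ʳ : ∀ b x y → (if b then x else 0ℚ) ℚ.* y ≡ (if b then x ℚ.* y else 0ℚ)
  if-*ʳ true  x y = refl
  if-*ʳ false x y = ℚP.*-zeroˡ y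

  -- One step of the chain seen from `σ`: pick `v`, then average `g` over the two spins at `v`.
  -- Taking `g` constant gives total mass 1, and taking the indicator of `V` gives the probability
  -- of entering `V`.
  expectation : ∀ σ {g : Spin N → ℚ} → Extensional g →
    ∑ S (λ τ → P σ τ ℚ.* g τ)
      ≡ ∑ vs (λ v → u ℚ.* (accept σ v ℚ.* g (flip σ v) ℚ.+ (1ℚ ℚ.- accept σ v) ℚ.* g σ))
  expectation σ {g} g-ext = begin
    ∑ S (λ τ → P σ τ ℚ.* g τ)
      ≡⟨ ∑-cong S (λ τ → sym (∑-*ʳ vs (g τ) (λ v → u ℚ.* (to τ v ℚ.+ stay τ v)))) ⟩
    ∑ S (λ τ → ∑ vs λ v → u ℚ.* (to τ v ℚ.+ stay τ v) ℚ.* g τ)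
      ≡⟨ ∑-swap S vs _ ⟩
    ∑ vs (λ v → ∑ S λ τ → u ℚ.* (to τ v ℚ.+ stay τ v) ℚ.* g τ)
      ≡⟨ ∑-cong vs (λ v → trans (∑-cong S (λ τ → pointwise τ v)) (trans (∑-*ˡ S u _)
           (cong (u ℚ.*_) (trans (∑-+ S _ _) (cong₂ ℚ._+_
             (∑-spins-δ (_≡ˢ flip σ v) (flip σ v) (λ e → cong (accept σ v ℚ.*_) (g-ext e))
               (λ τ → ≡ˢ-sound τ _) (λ τ → ≡ˢ-complete τ _))
             (∑-spins-δ (_≡ˢ σ) σ (λ e → cong ((1ℚ ℚ.- accept σ v) ℚ.*_) (g-ext e))
               (λ τ → ≡ˢ-sound τ _) (λ τ → ≡ˢ-complete τ _))))))) ⟩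
    ∑ vs (λ v → u ℚ.* (accept σ v ℚ.* g (flip σ v) ℚ.+ (1ℚ ℚ.- accept σ v) ℚ.* g σ)) ∎
    where
    open ≡-Reasoning
    to stay : Spin N → Fin N → ℚ
    to   τ v = if τ ≡ˢ flip σ v then accept σ v else 0ℚ
    stay τ v = if τ ≡ˢ σ then 1ℚ ℚ.- accept σ v else 0ℚ
    pointwise : ∀ τ v → u ℚ.* (to τ v ℚ.+ stay τ v) ℚ.* g τ
      ≡ u ℚ.* ((if τ ≡ˢ flip σ v then accept σ v ℚ.* g τ else 0ℚ)
               ℚ.+ (if τ ≡ˢ σ then (1ℚ ℚ.- accept σ v) ℚ.* g τ else 0ℚ))
    pointwise τ v = trans (ℚP.*-assoc u (to τ v ℚ.+ stay τ v) (g τ)) (cong (u ℚ.*_)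
      (trans (ℚP.*-distribʳ-+ (g τ) (to τ v) (stay τ v))
        (cong₂ ℚ._+_ (if-*ʳ (τ ≡ˢ flip σ v) _ _) (if-*ʳ (τ ≡ˢ σ) _ _))))

  ∑-P : ∀ σ → ∑ S (P σ) ≡ 1ℚ
  ∑-P σ = begin
    ∑ S (P σ)                     ≡⟨ ∑-cong S (λ τ → sym (ℚP.*-identityʳ (P σ τ))) ⟩
    ∑ S (λ τ → P σ τ ℚ.* 1ℚ)      ≡⟨ expectation σ (λ _ → refl) ⟩
    ∑ vs (λ v → u ℚ.* (accept σ v ℚ.* 1ℚ ℚ.+ (1ℚ ℚ.- accept σ v) ℚ.* 1ℚ))
                                  ≡⟨ ∑-cong vs (λ v → cong (u ℚ.*_) (one (accept σ v))) ⟩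
    ∑ vs (λ _ → u ℚ.* 1ℚ)         ≡⟨ ∑-u-const 1ℚ ⟩
    1ℚ                            ∎
    where
    open ≡-Reasoning
    one : ∀ p → p ℚ.* 1ℚ ℚ.+ (1ℚ ℚ.- p) ℚ.* 1ℚ ≡ 1ℚ
    one = solve 1 (λ p → p :* con 1ℚ :+ (con 1ℚ :- p) :* con 1ℚ := con 1ℚ) refl
      where open +-*-Solver

  -- Reversibility of a single-site update: the mass that `τ` receives from `flip τ v` replaces what
  -- it gives away. Once both acceptance probabilities are multiples of the same inverse `i`, this
  -- is a polynomial identity.
  balance : ∀ τ v →
    w (flip τ v) ℚ.* accept (flip τ v) v ℚ.+ w τ ℚ.* (1ℚ ℚ.- accept τ v) ≡ w τ
  balance τ v = begin
    w τ' ℚ.* accept τ' v ℚ.+ w τ ℚ.* (1ℚ ℚ.- accept τ v)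
      ≡⟨ cong₂ (λ p q → w τ' ℚ.* p ℚ.+ w τ ℚ.* (1ℚ ℚ.- q)) back (÷₀≡*1÷₀ (w τ') D) ⟩
    w τ' ℚ.* (w τ ℚ.* i) ℚ.+ w τ ℚ.* (1ℚ ℚ.- w τ' ℚ.* i)
      ≡⟨ ring (w τ) (w τ') i ⟩
    w τ ∎
    where
    open ≡-Reasoning
    τ' = flip τ v
    D = w τ ℚ.+ w τ'
    i = 1ℚ ÷₀ D
    back : accept τ' v ≡ w τ ℚ.* i
    back = trans (cong (λ z → z ÷₀ (w τ' ℚ.+ z)) (w-ext (flip-flip τ v)))
      (trans (cong (w τ ÷₀_) (ℚP.+-comm (w τ') (w τ))) (÷₀≡*1÷₀ (w τ) D))
    ring : ∀ a b i → b ℚ.* (a ℚ.* i) ℚ.+ a ℚ.* (1ℚ ℚ.- b ℚ.* i) ≡ a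
    ring = solve 3 (λ a b i → b :* (a :* i) :+ a :* (con 1ℚ :- b :* i) := a) refl
      where open +-*-Solver

  stationary : ∀ τ → ∑ S (λ σ → w σ ℚ.* P σ τ) ≡ w τ
  stationary τ = begin
    ∑ S (λ σ → w σ ℚ.* P σ τ)
      ≡⟨ ∑-cong S (λ σ → sym (∑-*ˡ vs (w σ) (λ v → u ℚ.* (to σ v ℚ.+ stay σ v)))) ⟩
    ∑ S (λ σ → ∑ vs λ v → w σ ℚ.* (u ℚ.* (to σ v ℚ.+ stay σ v)))
      ≡⟨ ∑-swap S vs _ ⟩
    ∑ vs (λ v → ∑ S λ σ → w σ ℚ.* (u ℚ.* (to σ v ℚ.+ stay σ v)))
      ≡⟨ ∑-cong vs (λ v → trans (∑-cong S (λ σ → pointwise σ v)) (trans (∑-*ˡ S u _)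
           (cong (u ℚ.*_) (trans (∑-+ S _ _) (trans (cong₂ ℚ._+_
             (∑-spins-δ (λ σ → τ ≡ˢ flip σ v) (flip τ v)
               (λ e → cong₂ ℚ._*_ (w-ext e) (accept-ext v e))
               (λ σ p i → trans (sym (flip-flip σ v i))
                                (flip-cong v (λ j → sym (≡ˢ-sound τ (flip σ v) p j)) i))
               (λ σ e → ≡ˢ-complete τ (flip σ v)
                 λ i → trans (sym (flip-flip τ v i)) (flip-cong v (λ j → sym (e j)) i)))
             (∑-spins-δ (τ ≡ˢ_) τ
               (λ e → cong₂ (λ a p → a ℚ.* (1ℚ ℚ.- p)) (w-ext e) (accept-ext v e))
               (λ σ p i → sym (≡ˢ-sound τ σ p i))
               (λ σ e → ≡ˢ-complete τ σ λ i → sym (e i))))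
             (balance τ v)))))) ⟩
    ∑ vs (λ _ → u ℚ.* w τ)
      ≡⟨ ∑-u-const (w τ) ⟩
    w τ ∎
    where
    open ≡-Reasoning
    to stay : Spin N → Fin N → ℚ
    to   σ v = if τ ≡ˢ flip σ v then accept σ v else 0ℚ
    stay σ v = if τ ≡ˢ σ then 1ℚ ℚ.- accept σ v else 0ℚ
    if-*ˡ : ∀ b x y → x ℚ.* (if b then y else 0ℚ) ≡ (if b then x ℚ.* y else 0ℚ)
    if-*ˡ true  x y = refl
    if-*ˡ false x y = ℚP.*-zeroʳ x
    pointwise : ∀ σ v → w σ ℚ.* (u ℚ.* (to σ v ℚ.+ stay σ v))
      ≡ u ℚ.* ((if τ ≡ˢ flip σ v then w σ ℚ.* accept σ v else 0ℚ)
               ℚ.+ (if τ ≡ˢ σ then w σ ℚ.* (1ℚ ℚ.- accept σ v) else 0ℚ))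
    pointwise σ v = trans (swap (w σ) u (to σ v) (stay σ v)) (cong (u ℚ.*_)
      (cong₂ ℚ._+_ (if-*ˡ (τ ≡ˢ flip σ v) (w σ) (accept σ v))
                   (if-*ˡ (τ ≡ˢ σ) (w σ) (1ℚ ℚ.- accept σ v))))
      where
      swap : ∀ a b c d → a ℚ.* (b ℚ.* (c ℚ.+ d)) ≡ b ℚ.* (a ℚ.* c ℚ.+ a ℚ.* d)
      swap = solve 4 (λ a b c d → a :* (b :* (c :+ d)) := b :* (a :* c :+ a :* d)) refl
        where open +-*-Solver

  law-nonNeg : ∀ ω t τ → 0ℚ ℚ.≤ law G μ ω t τ
  law-nonNeg ω zero    τ = if-nonNeg (τ ≡ˢ ω) (ℚP.nonNegative⁻¹ 1ℚ)
  law-nonNeg ω (suc t) τ = ∑-nonNeg S λ σ → *-nonNeg (law-nonNeg ω t σ) (P-nonNeg σ τ)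

  law-total : ∀ ω t → ∑ S (law G μ ω t) ≡ 1ℚ
  law-total ω zero    = ∑-spins-δ (_≡ˢ ω) ω (λ _ → refl)
    (λ τ → ≡ˢ-sound τ _) (λ τ → ≡ˢ-complete τ _)
  law-total ω (suc t) = begin
    ∑ S (λ τ → ∑ S λ σ → law G μ ω t σ ℚ.* P σ τ)
      ≡⟨ ∑-swap S S _ ⟩
    ∑ S (λ σ → ∑ S λ τ → law G μ ω t σ ℚ.* P σ τ)
      ≡⟨ ∑-cong S (λ σ → trans (∑-*ˡ S (law G μ ω t σ) (P σ))
           (trans (cong (law G μ ω t σ ℚ.*_) (∑-P σ)) (ℚP.*-identityʳ _))) ⟩
    ∑ S (law G μ ω t)
      ≡⟨ law-total ω t ⟩
    1ℚ ∎
    where open ≡-Reasoning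

  -- The point mass at ω is at most w / w ω, and domination by a stationary measure persists.
  law-dominated : ∀ ω t τ → law G μ ω t τ ℚ.* w ω ℚ.≤ w τ
  law-dominated ω zero τ with τ ≡ˢ ω in p
  ... | true  = ℚP.≤-reflexive (trans (ℚP.*-identityˡ (w ω)) (sym (w-ext (≡ˢ-sound τ ω p))))
  ... | false = subst (ℚ._≤ w τ) (sym (ℚP.*-zeroˡ (w ω))) (w-nonNeg τ)
  law-dominated ω (suc t) τ = begin
    ∑ S (λ σ → law G μ ω t σ ℚ.* P σ τ) ℚ.* w ω
      ≡⟨ sym (∑-*ʳ S (w ω) _) ⟩
    ∑ S (λ σ → law G μ ω t σ ℚ.* P σ τ ℚ.* w ω)
      ≡⟨ ∑-cong S (λ σ → shuffle (law G μ ω t σ) (P σ τ) (w ω)) ⟩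
    ∑ S (λ σ → law G μ ω t σ ℚ.* w ω ℚ.* P σ τ)
      ≤⟨ ∑-mono S (λ σ → *-mono-≤-nonNeg (P σ τ) (P-nonNeg σ τ) (law-dominated ω t σ)) ⟩
    ∑ S (λ σ → w σ ℚ.* P σ τ)
      ≡⟨ stationary τ ⟩
    w τ ∎
    where
    open ℚP.≤-Reasoning
    shuffle : ∀ a b c → a ℚ.* b ℚ.* c ≡ a ℚ.* c ℚ.* b
    shuffle = solve 3 (λ a b c → a :* b :* c := a :* c :* b) refl
      where open +-*-Solver

  -- `V` is the half to be reached and `B` the layer just outside it: by `entry`, a step from
  -- outside `V` into `V` starts in `B`. `thin` compares each state of `B` with the start `ω`, not
  -- with `Z`, which is the form that `law-dominated` can use at every time.
  module Bottleneck
    (V B : Spin N → Bool) (V-ext : Extensional V)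
    (V-not : ∀ σ → V σ ≡ false → V (not ∘ σ) ≡ true)
    (entry : ∀ σ v → V σ ≡ false → B σ ≡ false → V (flip σ v) ≡ false)
    (ω : Spin N) (ω∉V : V ω ≡ false)
    (δ : ℚ) (0≤δ : 0ℚ ℚ.≤ δ) (thin : ∀ σ → B σ ≡ true → w σ ℚ.≤ δ ℚ.* w ω)
    where

    private
      𝟙V : Spin N → ℚ
      𝟙V σ = if V σ then 1ℚ else 0ℚ
      π = gibbs G μ
      Zw = Z G μ

    𝟙V-ext : Extensional 𝟙V
    𝟙V-ext e = cong (λ b → if b then 1ℚ else 0ℚ) (V-ext e)

    ε : ℚ
    ε = ∑ S (λ _ → δ)

    law-≤-δ : ∀ t σ → B σ ≡ true → law G μ ω t σ ℚ.≤ δ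
    law-≤-δ t σ Bσ = *-cancel-≤-pos (w ω) (w-pos ω)
      (ℚP.≤-trans (law-dominated ω t σ) (thin σ Bσ))

    into-V : Spin N → ℚ
    into-V σ = ∑ S (λ τ → P σ τ ℚ.* 𝟙V τ)

    into-V-≤-1 : ∀ σ → into-V σ ℚ.≤ 1ℚ
    into-V-≤-1 σ = subst (into-V σ ℚ.≤_) (∑-P σ) (∑-mono S bound)
      where
      bound : ∀ τ → P σ τ ℚ.* 𝟙V τ ℚ.≤ P σ τ
      bound τ with V τ
      ... | true  = ℚP.≤-reflexive (ℚP.*-identityʳ (P σ τ))
      ... | false = subst (ℚ._≤ P σ τ) (sym (ℚP.*-zeroʳ (P σ τ))) (P-nonNeg σ τ)

    into-V-outside : ∀ σ → V σ ≡ false → B σ ≡ false → into-V σ ≡ 0ℚ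
    into-V-outside σ Vσ Bσ = trans (expectation σ 𝟙V-ext)
      (trans (∑-cong vs vanish) (∑-zero vs))
      where
      vanish : ∀ v → u ℚ.* (accept σ v ℚ.* 𝟙V (flip σ v) ℚ.+ (1ℚ ℚ.- accept σ v) ℚ.* 𝟙V σ) ≡ 0ℚ
      vanish v rewrite Vσ | entry σ v Vσ Bσ = ring u (accept σ v)
        where
        ring : ∀ a p → a ℚ.* (p ℚ.* 0ℚ ℚ.+ (1ℚ ℚ.- p) ℚ.* 0ℚ) ≡ 0ℚ
        ring = solve 2 (λ a p → a :* (p :* con 0ℚ :+ (con 1ℚ :- p) :* con 0ℚ) := con 0ℚ) refl
          where open +-*-Solver

    -- Per step, mass enters `V` only from states of `B`, each carrying at most `δ`. Charging `δ` to
    -- every state of the space instead of counting `B` makes `ε` explicit.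
    escape : ∀ t → ∑ S (λ σ → law G μ ω t σ ℚ.* 𝟙V σ) ℚ.≤ t ×ℚ ε
    escape zero = ℚP.≤-reflexive (trans (∑-cong S start) (∑-zero S))
      where
      start : ∀ σ → law G μ ω 0 σ ℚ.* 𝟙V σ ≡ 0ℚ
      start σ with σ ≡ˢ ω in p
      ... | false = ℚP.*-zeroˡ (𝟙V σ)
      ... | true  rewrite V-ext (≡ˢ-sound σ ω p) | ω∉V = refl
    escape (suc t) = begin
      ∑ S (λ τ → ∑ S (λ σ → L σ ℚ.* P σ τ) ℚ.* 𝟙V τ)
        ≡⟨ ∑-cong S (λ τ → sym (∑-*ʳ S (𝟙V τ) (λ σ → L σ ℚ.* P σ τ))) ⟩
      ∑ S (λ τ → ∑ S λ σ → L σ ℚ.* P σ τ ℚ.* 𝟙V τ)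
        ≡⟨ ∑-swap S S _ ⟩
      ∑ S (λ σ → ∑ S λ τ → L σ ℚ.* P σ τ ℚ.* 𝟙V τ)
        ≡⟨ ∑-cong S (λ σ → trans (∑-cong S (λ τ → ℚP.*-assoc (L σ) (P σ τ) (𝟙V τ)))
                                 (∑-*ˡ S (L σ) _)) ⟩
      ∑ S (λ σ → L σ ℚ.* into-V σ)
        ≤⟨ ∑-mono S bound ⟩
      ∑ S (λ σ → δ ℚ.+ L σ ℚ.* 𝟙V σ)
        ≡⟨ ∑-+ S _ _ ⟩
      ε ℚ.+ ∑ S (λ σ → L σ ℚ.* 𝟙V σ)
        ≤⟨ ℚP.+-monoʳ-≤ ε (escape t) ⟩
      ε ℚ.+ t ×ℚ ε ∎
      where
      open ℚP.≤-Reasoning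
      L = law G μ ω t
      L*into-V≤L : ∀ σ → L σ ℚ.* into-V σ ℚ.≤ L σ
      L*into-V≤L σ = subst₂ ℚ._≤_ (ℚP.*-comm (into-V σ) (L σ)) (ℚP.*-identityˡ (L σ))
        (*-mono-≤-nonNeg (L σ) (law-nonNeg ω t σ) (into-V-≤-1 σ))
      bound : ∀ σ → L σ ℚ.* into-V σ ℚ.≤ δ ℚ.+ L σ ℚ.* 𝟙V σ
      bound σ with V σ in Vσ | B σ in Bσ
      ... | true | _ = ℚP.≤-trans (L*into-V≤L σ)
        (subst₂ ℚ._≤_ (ℚP.+-identityˡ (L σ)) (cong (δ ℚ.+_) (sym (ℚP.*-identityʳ (L σ))))
          (ℚP.+-monoˡ-≤ (L σ) 0≤δ))
      ... | false | true = ℚP.≤-trans (L*into-V≤L σ) (ℚP.≤-trans (law-≤-δ t σ Bσ)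
        (ℚP.≤-reflexive (sym (trans (cong (δ ℚ.+_) (ℚP.*-zeroʳ (L σ))) (ℚP.+-identityʳ δ)))))
      ... | false | false = ℚP.≤-trans
        (ℚP.≤-reflexive (trans (cong (L σ ℚ.*_) (into-V-outside σ Vσ Bσ)) (ℚP.*-zeroʳ (L σ))))
        (ℚP.≤-trans 0≤δ (ℚP.≤-reflexive
          (sym (trans (cong (δ ℚ.+_) (ℚP.*-zeroʳ (L σ))) (ℚP.+-identityʳ δ)))))

    Z-pos : 0ℚ ℚ.< Zw
    Z-pos = ℚP.<-≤-trans (w-pos ω) (subst (ℚ._≤ Zw)
      (∑-spins-δ (_≡ˢ ω) ω w-ext (λ τ → ≡ˢ-sound τ _) (λ τ → ≡ˢ-complete τ _))
      (∑-mono S bound))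
      where
      bound : ∀ σ → (if σ ≡ˢ ω then w σ else 0ℚ) ℚ.≤ w σ
      bound σ with σ ≡ˢ ω
      ... | true  = ℚP.≤-refl
      ... | false = w-nonNeg σ

    ∑-gibbs-* : ∀ (g : Spin N → ℚ) → ∑ S (λ σ → π σ ℚ.* g σ) ≡ ∑ S (λ σ → w σ ℚ.* g σ) ÷₀ Zw
    ∑-gibbs-* g = begin
      ∑ S (λ σ → π σ ℚ.* g σ)
        ≡⟨ ∑-cong S (λ σ → trans (cong (ℚ._* g σ) (÷₀≡*1÷₀ (w σ) Zw)) (shuffle (w σ) (1ℚ ÷₀ Zw) (g σ))) ⟩
      ∑ S (λ σ → w σ ℚ.* g σ ℚ.* (1ℚ ÷₀ Zw))
        ≡⟨ ∑-*ʳ S (1ℚ ÷₀ Zw) _ ⟩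
      ∑ S (λ σ → w σ ℚ.* g σ) ℚ.* (1ℚ ÷₀ Zw)
        ≡⟨ sym (÷₀≡*1÷₀ _ Zw) ⟩
      ∑ S (λ σ → w σ ℚ.* g σ) ÷₀ Zw ∎
      where
      open ≡-Reasoning
      shuffle : ∀ a b c → a ℚ.* b ℚ.* c ≡ a ℚ.* c ℚ.* b
      shuffle = solve 3 (λ a b c → a :* b :* c := a :* c :* b) refl
        where open +-*-Solver

    Z÷Z : Zw ÷₀ Zw ≡ 1ℚ
    Z÷Z = ℚP.≤-antisym (÷₀-≤-1 ℚP.≤-refl Z-pos) (*-cancel-≤-pos Zw Z-pos
      (ℚP.≤-reflexive (trans (ℚP.*-identityˡ Zw) (sym (÷₀-*-cancel Zw Z-pos)))))

    gibbs-total : ∑ S π ≡ 1ℚ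
    gibbs-total = begin
      ∑ S π                          ≡⟨ ∑-cong S (λ σ → sym (ℚP.*-identityʳ (π σ))) ⟩
      ∑ S (λ σ → π σ ℚ.* 1ℚ)         ≡⟨ ∑-gibbs-* (λ _ → 1ℚ) ⟩
      ∑ S (λ σ → w σ ℚ.* 1ℚ) ÷₀ Zw   ≡⟨ cong (_÷₀ Zw) (∑-cong S λ σ → ℚP.*-identityʳ (w σ)) ⟩
      Zw ÷₀ Zw                       ≡⟨ Z÷Z ⟩
      1ℚ                             ∎
      where open ≡-Reasoning

    -- The weight is invariant under the global flip, and `V` together with its flipped copy covers
    -- all states.
    gibbs-V : ½ ℚ.≤ ∑ S (λ σ → π σ ℚ.* 𝟙V σ)
    gibbs-V = 1≤x+x⇒½≤x (*-cancel-≤-pos Zw Z-pos (subst₂ ℚ._≤_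
      (sym (ℚP.*-identityˡ Zw)) (sym double) half-weight))
      where
      wV : ℚ
      wV = ∑ S (λ σ → w σ ℚ.* 𝟙V σ)
      πV : ℚ
      πV = ∑ S (λ σ → π σ ℚ.* 𝟙V σ)
      double : (πV ℚ.+ πV) ℚ.* Zw ≡ wV ℚ.+ wV
      double = trans (ℚP.*-distribʳ-+ Zw πV πV) (cong₂ ℚ._+_ clear clear)
        where
        clear : πV ℚ.* Zw ≡ wV
        clear = trans (cong (ℚ._* Zw) (∑-gibbs-* 𝟙V)) (÷₀-*-cancel wV Z-pos)
      w-not : ∀ σ → w (not ∘ σ) ≡ w σ
      w-not σ = cong (μ ^ℚ_) (cutSize-not G σ)
      cover : ∀ σ → w σ ℚ.≤ w σ ℚ.* 𝟙V σ ℚ.+ w (not ∘ σ) ℚ.* 𝟙V (not ∘ σ)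
      cover σ with V σ in Vσ
      ... | true  = subst (ℚ._≤ w σ ℚ.* 1ℚ ℚ.+ w (not ∘ σ) ℚ.* 𝟙V (not ∘ σ)) (ℚP.*-identityʳ (w σ)) (≤-0+
        (*-nonNeg (w-nonNeg (not ∘ σ)) (if-nonNeg (V (not ∘ σ)) (ℚP.nonNegative⁻¹ 1ℚ))))
      ... | false rewrite V-not σ Vσ | w-not σ = ℚP.≤-reflexive (ring (w σ))
        where
        ring : ∀ a → a ≡ a ℚ.* 0ℚ ℚ.+ a ℚ.* 1ℚ
        ring = solve 1 (λ a → a := a :* con 0ℚ :+ a :* con 1ℚ) refl
          where open +-*-Solver
      half-weight : Zw ℚ.≤ wV ℚ.+ wV
      half-weight = ℚP.≤-trans (∑-mono S cover) (ℚP.≤-reflexive (trans (∑-+ S _ _)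
        (cong (wV ℚ.+_) (∑-spins-not (λ e → cong₂ ℚ._*_ (w-ext e) (𝟙V-ext e))))))

    -- Bounding `π(V) - L(V)` by the sum of absolute differences would lose the factor `½` of `dTV`.
    -- The pointwise inequality bounds the signed difference `π - L` on `V` and `L - π` off `V`;
    -- since both laws have mass 1, these two parts contribute the same amount.
    gibbs-V-≤ : ∀ t → ∑ S (λ σ → π σ ℚ.* 𝟙V σ)
      ℚ.≤ dTV (law G μ ω t) π ℚ.+ ∑ S (λ σ → law G μ ω t σ ℚ.* 𝟙V σ)
    gibbs-V-≤ t = cancel summed
      where
      L = law G μ ω t
      πV LV D : ℚ
      πV = ∑ S (λ σ → π σ ℚ.* 𝟙V σ)
      LV = ∑ S (λ σ → L σ ℚ.* 𝟙V σ)
      D  = ∑ S (λ σ → ℚ.∣ L σ ℚ.- π σ ∣)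
      pointwise : ∀ σ → (π σ ℚ.* 𝟙V σ ℚ.+ π σ ℚ.* 𝟙V σ) ℚ.+ L σ
        ℚ.≤ (ℚ.∣ L σ ℚ.- π σ ∣ ℚ.+ π σ) ℚ.+ (L σ ℚ.* 𝟙V σ ℚ.+ L σ ℚ.* 𝟙V σ)
      pointwise σ with V σ
      ... | true  = subst (ℚ._≤ (ℚ.∣ L σ ℚ.- π σ ∣ ℚ.+ π σ) ℚ.+ (L σ ℚ.* 1ℚ ℚ.+ L σ ℚ.* 1ℚ))
        (ring (π σ) (L σ)) (ℚP.+-monoˡ-≤ _ (ℚP.+-monoˡ-≤ (π σ) (-p≤∣p∣ (L σ ℚ.- π σ))))
        where
        ring : ∀ a l → (ℚ.- (l ℚ.- a) ℚ.+ a) ℚ.+ (l ℚ.* 1ℚ ℚ.+ l ℚ.* 1ℚ)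
          ≡ (a ℚ.* 1ℚ ℚ.+ a ℚ.* 1ℚ) ℚ.+ l
        ring = solve 2 (λ a l → (:- (l :- a) :+ a) :+ (l :* con 1ℚ :+ l :* con 1ℚ)
          := (a :* con 1ℚ :+ a :* con 1ℚ) :+ l) refl
          where open +-*-Solver
      ... | false = subst (ℚ._≤ (ℚ.∣ L σ ℚ.- π σ ∣ ℚ.+ π σ) ℚ.+ (L σ ℚ.* 0ℚ ℚ.+ L σ ℚ.* 0ℚ))
        (ring (π σ) (L σ)) (ℚP.+-monoˡ-≤ _ (ℚP.+-monoˡ-≤ (π σ) (p≤∣p∣ (L σ ℚ.- π σ))))
        where
        ring : ∀ a l → ((l ℚ.- a) ℚ.+ a) ℚ.+ (l ℚ.* 0ℚ ℚ.+ l ℚ.* 0ℚ)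
          ≡ (a ℚ.* 0ℚ ℚ.+ a ℚ.* 0ℚ) ℚ.+ l
        ring = solve 2 (λ a l → ((l :- a) :+ a) :+ (l :* con 0ℚ :+ l :* con 0ℚ)
          := (a :* con 0ℚ :+ a :* con 0ℚ) :+ l) refl
          where open +-*-Solver
      summed : (πV ℚ.+ πV) ℚ.+ 1ℚ ℚ.≤ (D ℚ.+ 1ℚ) ℚ.+ (LV ℚ.+ LV)
      summed = subst₂ ℚ._≤_
        (trans (∑-+ S _ _) (cong₂ ℚ._+_ (∑-+ S _ _) (law-total ω t)))
        (trans (∑-+ S _ _) (cong₂ ℚ._+_ (trans (∑-+ S _ _) (cong (D ℚ.+_) gibbs-total)) (∑-+ S _ _)))
        (∑-mono S pointwise)
      cancel : (πV ℚ.+ πV) ℚ.+ 1ℚ ℚ.≤ (D ℚ.+ 1ℚ) ℚ.+ (LV ℚ.+ LV) → πV ℚ.≤ ½ ℚ.* D ℚ.+ LV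
      cancel h = subst₂ ℚ._≤_ (lhs πV) (rhs D LV)
        (ℚP.*-monoˡ-≤-nonNeg ½ (ℚP.+-monoˡ-≤ (ℚ.- 1ℚ) h))
        where
        open +-*-Solver
        lhs : ∀ a → ½ ℚ.* ((a ℚ.+ a) ℚ.+ 1ℚ ℚ.+ ℚ.- 1ℚ) ≡ a
        lhs = solve 1 (λ a → con ½ :* ((a :+ a) :+ con 1ℚ :+ :- con 1ℚ) := a) refl
        rhs : ∀ d l → ½ ℚ.* ((d ℚ.+ 1ℚ) ℚ.+ (l ℚ.+ l) ℚ.+ ℚ.- 1ℚ) ≡ ½ ℚ.* d ℚ.+ l
        rhs = solve 2 (λ d l → con ½ :* ((d :+ con 1ℚ) :+ (l :+ l) :+ :- con 1ℚ)
          := con ½ :* d :+ l) refl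

    mixed⇒quarter≤escape : ∀ t → dTV (law G μ ω t) π ℚ.≤ quarter → quarter ℚ.≤ t ×ℚ ε
    mixed⇒quarter≤escape t mixed = subst₂ ℚ._≤_ refl (ring (t ×ℚ ε))
      (ℚP.+-monoʳ-≤ (ℚ.- quarter) (ℚP.≤-trans gibbs-V
        (ℚP.≤-trans (gibbs-V-≤ t) (ℚP.+-mono-≤ mixed (escape t)))))
      where
      open +-*-Solver
      ring : ∀ x → ℚ.- quarter ℚ.+ (quarter ℚ.+ x) ≡ x
      ring = solve 1 (λ x → con (ℚ.- quarter) :+ (con quarter :+ x) := x) refl

-- Greedy matching

open ΣN

𝟙 : Bool → ℕ
𝟙 b = if b then 1 else 0

true⇒T : ∀ {b} → b ≡ true → T b
true⇒T refl = tt

𝟙≤1 : ∀ b → 𝟙 b ≤ 1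
𝟙≤1 true  = s≤s z≤n
𝟙≤1 false = z≤n

∑-const : ∀ {X : Set} (xs : List X) c → ∑ xs (λ _ → c) ≡ length xs * c
∑-const []       c = refl
∑-const (x ∷ xs) c = cong (c ℕ.+_) (∑-const xs c)

∑-fin-1 : ∀ n → ∑ (allFin n) (λ _ → 1) ≡ n
∑-fin-1 n = trans (∑-const (allFin n) 1)
  (trans (ℕP.*-identityʳ _) (ListP.length-tabulate {n = n} (λ i → i)))

∑-take-≤ : ∀ {X : Set} k (xs : List X) (f : X → ℕ) → ∑ (take k xs) f ≤ ∑ xs f
∑-take-≤ zero    xs       f = z≤n
∑-take-≤ (suc k) []       f = z≤n
∑-take-≤ (suc k) (x ∷ xs) f = ℕP.+-monoʳ-≤ (f x) (∑-take-≤ k xs f)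

term≤∑-spins : ∀ {n} {f : Spin n → ℕ} → Extensional f → ∀ τ → f τ ≤ ∑ (allSpins n) f
term≤∑-spins {zero} {f} f-ext τ = ℕP.≤-trans (ℕP.≤-reflexive (f-ext λ ())) (ℕP.m≤m+n _ 0)
term≤∑-spins {suc n} {f} f-ext τ = subst (f τ ≤_) (sym (∑-spins-suc f-ext)) (half (τ zero) refl)
  where
  part : Bool → ℕ
  part b = ∑ (allSpins n) (λ σ → f (b ▸ σ))
  own : ∀ b → τ zero ≡ b → f τ ≤ part b
  own b e = subst (_≤ part b) (f-ext λ { zero → sym e ; (suc i) → refl })
    (term≤∑-spins (λ e' → f-ext (▸-cong b e')) (λ i → τ (suc i)))
  half : ∀ b → τ zero ≡ b → f τ ≤ part true + part false
  half true  e = ℕP.≤-trans (own true e) (ℕP.m≤m+n _ _)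
  half false e = ℕP.≤-trans (own false e) (ℕP.m≤n+m _ _)

-- If the head lies above the average, the average of the tail only gets smaller. That `t' ∷ R'`
-- rearranges the list is expressed by equality of all sums, the form in which the greedy step
-- consumes it.
below-average : ∀ {X : Set} t (R : List X) (f : X → ℕ) c → ∑ (t ∷ R) f ≤ suc (length R) * c →
  Σ X λ t' → Σ (List X) λ R' → (length R ≡ length R')
    × (∀ g → ∑ (t ∷ R) g ≡ g t' + ∑ R' g) × f t' ≤ c
below-average t [] f c avg = t , [] , refl , (λ g → refl) ,
  subst₂ _≤_ (ℕP.+-identityʳ (f t)) (ℕP.+-identityʳ c) avg
below-average t (r ∷ R) f c avg with f t ≤? c
... | yes ft≤c = t , r ∷ R , refl , (λ g → refl) , ft≤c
... | no  ft≰c =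
  let t' , R' , len , split , ft'≤c = below-average r R f c
        (ℕP.+-cancelˡ-≤ c _ _ (ℕP.≤-trans (ℕP.+-monoˡ-≤ _ (ℕP.<⇒≤ (ℕP.≰⇒> ft≰c))) avg))
  in t' , t ∷ R' , cong suc len ,
     (λ g → trans (cong (g t ℕ.+_) (split g)) (exchange (g t) (g t') _)) , ft'≤c
  where
  exchange : ∀ a b c → a + (b + c) ≡ b + (a + c)
  exchange = solve-∀

module Weights (ν : ℕ) where

  -- An auxiliary potential, unrelated to the Gibbs weight. The weight of a configuration is `suc ν`
  -- to the number of satisfied links, so an upper bound on it is a lower bound on the number of
  -- violations; the lemmas ending in `-^` say this without subtraction.
  edgeWeight : Bool → Bool → ℕ
  edgeWeight a b = if a xor b then 1 else suc ν

  edgeWeight-xor : ∀ a b → edgeWeight a b + ν * 𝟙 (a xor b) ≡ suc ν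
  edgeWeight-xor a b with a xor b
  ... | true  = cong suc (ℕP.*-identityʳ ν)
  ... | false = trans (cong (suc ν ℕ.+_) (ℕP.*-zeroʳ ν)) (ℕP.+-identityʳ (suc ν))

  edgeWeight-^ : ∀ a b → edgeWeight a b * suc ν ^ 𝟙 (a xor b) ≡ suc ν
  edgeWeight-^ a b with a xor b
  ... | true  = trans (ℕP.*-identityˡ _) (ℕP.*-identityʳ (suc ν))
  ... | false = ℕP.*-identityʳ (suc ν)

  pairsViolated : ∀ {n} → List (Fin n × Fin n) → Spin n → ℕ
  pairsViolated ps T = ∑ ps (λ p → 𝟙 (T (proj₁ p) xor T (proj₂ p)))

  pairsWeight : ∀ {n} → List (Fin n × Fin n) → Spin n → ℕ
  pairsWeight []             T = 1
  pairsWeight ((s , t) ∷ ps) T = edgeWeight (T s) (T t) * pairsWeight ps T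

  pairsWeight-^ : ∀ {n} (ps : List (Fin n × Fin n)) T →
    pairsWeight ps T * suc ν ^ pairsViolated ps T ≡ suc ν ^ length ps
  pairsWeight-^ []             T = refl
  pairsWeight-^ ((s , t) ∷ ps) T = begin
    e * W * suc ν ^ (x + V)            ≡⟨ cong (e * W *_) (ℕP.^-distribˡ-+-* (suc ν) x V) ⟩
    e * W * (suc ν ^ x * suc ν ^ V)    ≡⟨ regroup e W (suc ν ^ x) (suc ν ^ V) ⟩
    e * suc ν ^ x * (W * suc ν ^ V)    ≡⟨ cong₂ _*_ (edgeWeight-^ (T s) (T t)) (pairsWeight-^ ps T) ⟩
    suc ν * suc ν ^ length ps          ∎
    where
    open ≡-Reasoning
    e = edgeWeight (T s) (T t)
    W = pairsWeight ps T
    V = pairsViolated ps T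
    x = 𝟙 (T s xor T t)
    regroup : ∀ a b c d → a * b * (c * d) ≡ a * c * (b * d)
    regroup = solve-∀

  pairsWeight-ext : ∀ {n} (ps : List (Fin n × Fin n)) → Extensional (pairsWeight ps)
  pairsWeight-ext []             e = refl
  pairsWeight-ext ((s , t) ∷ ps) e =
    cong₂ _*_ (cong₂ edgeWeight (e s) (e t)) (pairsWeight-ext ps e)

  pathViolated : ∀ {n} → Spin n → ℕ
  pathViolated {zero}        T = 0
  pathViolated {suc zero}    T = 0
  pathViolated {suc (suc n)} T = 𝟙 (T zero xor T (suc zero)) + pathViolated (T ∘ suc)

  pathWeight : ∀ {n} → Spin n → ℕ
  pathWeight {zero}        T = 1
  pathWeight {suc zero}    T = 1
  pathWeight {suc (suc n)} T = edgeWeight (T zero) (T (suc zero)) * pathWeight (T ∘ suc)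

  pathWeight-^ : ∀ {n} (T : Spin (suc n)) → pathWeight T * suc ν ^ pathViolated T ≡ suc ν ^ n
  pathWeight-^ {zero}  T = refl
  pathWeight-^ {suc n} T = begin
    e * W * suc ν ^ (x + V)            ≡⟨ cong (e * W *_) (ℕP.^-distribˡ-+-* (suc ν) x V) ⟩
    e * W * (suc ν ^ x * suc ν ^ V)    ≡⟨ regroup e W (suc ν ^ x) (suc ν ^ V) ⟩
    e * suc ν ^ x * (W * suc ν ^ V)    ≡⟨ cong₂ _*_ (edgeWeight-^ (T zero) (T (suc zero))) (pathWeight-^ (T ∘ suc)) ⟩
    suc ν * suc ν ^ n                  ∎
    where
    open ≡-Reasoning
    e = edgeWeight (T zero) (T (suc zero))
    W = pathWeight (T ∘ suc)
    V = pathViolated (T ∘ suc)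
    x = 𝟙 (T zero xor T (suc zero))
    regroup : ∀ a b c d → a * b * (c * d) ≡ a * c * (b * d)
    regroup = solve-∀

  pathWeight-ext : ∀ {n} → Extensional (pathWeight {n})
  pathWeight-ext {zero}        e = refl
  pathWeight-ext {suc zero}    e = refl
  pathWeight-ext {suc (suc n)} e =
    cong₂ _*_ (cong₂ edgeWeight (e zero) (e (suc zero))) (pathWeight-ext (e ∘ suc))

  -- Transfer matrix: whatever the previous spin, the two choices for the next one contribute `1`
  -- and `suc ν`, so the sum factorises exactly.
  ∑-pathWeight-▸ : ∀ n b → ∑ (allSpins n) (λ T → pathWeight (b ▸ T)) ≡ suc (suc ν) ^ n
  ∑-pathWeight-▸ zero    b = refl
  ∑-pathWeight-▸ (suc n) b = begin
    ∑ (allSpins (suc n)) (λ T → pathWeight (b ▸ T))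
      ≡⟨ ∑-spins-suc {n} (λ e → pathWeight-ext (▸-cong b e)) ⟩
    ∑ (allSpins n) (λ T → pathWeight (b ▸ true ▸ T)) + ∑ (allSpins n) (λ T → pathWeight (b ▸ false ▸ T))
      ≡⟨ cong₂ _+_ (next true) (next false) ⟩
    edgeWeight b true * suc (suc ν) ^ n + edgeWeight b false * suc (suc ν) ^ n
      ≡⟨ total b (suc (suc ν) ^ n) ⟩
    suc (suc ν) * suc (suc ν) ^ n ∎
    where
    open ≡-Reasoning
    next : ∀ c → ∑ (allSpins n) (λ T → pathWeight (b ▸ c ▸ T)) ≡ edgeWeight b c * suc (suc ν) ^ n
    next c = trans
      (∑-cong (allSpins n) λ T → cong (edgeWeight b c *_)
        (pathWeight-ext {σ = (b ▸ c ▸ T) ∘ suc} {τ = c ▸ T} λ _ → refl))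
      (trans (∑-*ˡ (allSpins n) (edgeWeight b c) _) (cong (edgeWeight b c *_) (∑-pathWeight-▸ n c)))
    total : ∀ b z → edgeWeight b true * z + edgeWeight b false * z ≡ suc (suc ν) * z
    total true  z = trans (sym (ℕP.*-distribʳ-+ z (suc ν) 1)) (cong (_* z) (ℕP.+-comm (suc ν) 1))
    total false z = sym (ℕP.*-distribʳ-+ z 1 (suc ν))

  ∑-pathWeight : ∀ n → ∑ (allSpins (suc n)) pathWeight ≡ 2 * suc (suc ν) ^ n
  ∑-pathWeight n = trans (∑-spins-suc {n} pathWeight-ext)
    (trans (cong₂ _+_ (∑-pathWeight-▸ n true) (∑-pathWeight-▸ n false))
      (cong (suc (suc ν) ^ n ℕ.+_) (sym (ℕP.+-identityʳ _))))

  differing : ∀ {n} → Bool → List (Fin n) → Spin n → ℕ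
  differing β R T = ∑ R (λ t → 𝟙 (β xor T t))

  -- At least a quarter of the targets disagree with `β`, so an average target has weight at most
  -- `1/4 + 3/4 * (1 + ν)`, which is `(4 + 3 * ν) / 4`.
  ∑-edgeWeight : ∀ {n} (R : List (Fin n)) T β b → length R ≤ 4 * b → b ≤ differing β R T →
    4 * ∑ R (λ t → edgeWeight β (T t)) ≤ length R * (4 + 3 * ν)
  ∑-edgeWeight R T β b len bal = ℕP.+-cancelʳ-≤ (ν * length R) _ _ (begin
    4 * E + ν * length R           ≤⟨ ℕP.+-monoʳ-≤ (4 * E) (ℕP.*-monoʳ-≤ ν
                                        (ℕP.≤-trans len (ℕP.*-monoʳ-≤ 4 bal))) ⟩
    4 * E + ν * (4 * Df)           ≡⟨ collect E ν Df ⟩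
    4 * (E + ν * Df)               ≡⟨ cong (4 *_) total ⟩
    4 * (length R * suc ν)         ≡⟨ expand (length R) ν ⟩
    length R * (4 + 3 * ν) + ν * length R ∎)
    where
    open ℕP.≤-Reasoning
    E = ∑ R (λ t → edgeWeight β (T t))
    Df = differing β R T
    total : E + ν * Df ≡ length R * suc ν
    total = trans (cong (E ℕ.+_) (sym (∑-*ˡ R ν _))) (trans (sym (∑-+ R _ _))
      (trans (∑-cong R λ t → edgeWeight-xor β (T t)) (∑-const R (suc ν))))
    collect : ∀ e v d → 4 * e + v * (4 * d) ≡ 4 * (e + v * d)
    collect = solve-∀
    expand : ∀ l v → 4 * (l * suc v) ≡ l * (4 + 3 * v) + v * l
    expand = solve-∀

  -- Method of conditional expectations: each source is matched with the remaining target
  -- that makes the total weight of the balanced configurations smallest.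
  module _ {n} (xs : List (Spin n)) (b : ℕ) where

    greedy : (ss R : List (Fin n)) (a : Spin n → ℕ) → length ss ≤ length R → length R ≤ 4 * b →
      (∀ T → a T ≡ 0 ⊎ (∀ β → length ss + b ≤ differing β R T)) →
      Σ (List (Fin n × Fin n)) λ ps →
        (map proj₁ ps ≡ ss) × (∀ g → ∑ ps (g ∘ proj₂) ≤ ∑ R g) ×
        4 ^ length ss * ∑ xs (λ T → a T * pairsWeight ps T) ≤ (4 + 3 * ν) ^ length ss * ∑ xs a
    greedy [] R a _ _ _ = [] , refl , (λ g → z≤n) ,
      ℕP.≤-reflexive (cong (1 *_) (∑-cong xs λ T → ℕP.*-identityʳ (a T)))
    greedy (s ∷ ss) R@(r₀ ∷ R₀) a enough len bal
      with below-average r₀ R₀ (λ t → 4 * ∑ xs (λ T → a T * edgeWeight (T s) (T t))) ((4 + 3 * ν) * ∑ xs a)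
             avg
      where
      open ℕP.≤-Reasoning
      bound : ∀ T → a T * (4 * ∑ R (λ t → edgeWeight (T s) (T t))) ≤ a T * (length R * (4 + 3 * ν))
      bound T with bal T
      ... | inj₁ aT≡0 rewrite aT≡0 = z≤n
      ... | inj₂ balT = ℕP.*-monoʳ-≤ (a T) (∑-edgeWeight R T (T s) b len
              (ℕP.≤-trans (ℕP.m≤n+m b (suc (length ss))) (balT (T s))))
      avg : ∑ R (λ t → 4 * ∑ xs (λ T → a T * edgeWeight (T s) (T t))) ≤ length R * ((4 + 3 * ν) * ∑ xs a)
      avg = begin
        ∑ R (λ t → 4 * ∑ xs (λ T → a T * edgeWeight (T s) (T t)))
          ≡⟨ ∑-*ˡ R 4 (λ t → ∑ xs (λ T → a T * edgeWeight (T s) (T t))) ⟩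
        4 * ∑ R (λ t → ∑ xs (λ T → a T * edgeWeight (T s) (T t)))
          ≡⟨ cong (4 *_) (∑-swap R xs _) ⟩
        4 * ∑ xs (λ T → ∑ R (λ t → a T * edgeWeight (T s) (T t)))
          ≡⟨ sym (∑-*ˡ xs 4 _) ⟩
        ∑ xs (λ T → 4 * ∑ R (λ t → a T * edgeWeight (T s) (T t)))
          ≡⟨ ∑-cong xs (λ T → trans (cong (4 *_) (∑-*ˡ R (a T) _)) (swap 4 (a T) _)) ⟩
        ∑ xs (λ T → a T * (4 * ∑ R (λ t → edgeWeight (T s) (T t))))
          ≤⟨ ∑-mono xs bound ⟩
        ∑ xs (λ T → a T * (length R * (4 + 3 * ν)))
          ≡⟨ ∑-*ʳ xs _ a ⟩
        ∑ xs a * (length R * (4 + 3 * ν))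
          ≡⟨ rotate (∑ xs a) (length R) (4 + 3 * ν) ⟩
        length R * ((4 + 3 * ν) * ∑ xs a) ∎
        where
        swap : ∀ a b c → a * (b * c) ≡ b * (a * c)
        swap = solve-∀
        rotate : ∀ a b c → a * (b * c) ≡ b * (c * a)
        rotate = solve-∀
    ... | t , R' , lenR , split , small
      with greedy ss R' (λ T → a T * edgeWeight (T s) (T t))
             (subst (length ss ≤_) lenR (ℕP.≤-pred enough))
             (subst (_≤ 4 * b) lenR (ℕP.≤-trans (ℕP.n≤1+n _) len)) bal'
      where
      -- Removing the target `t` lowers `differing` by at most one, which the source just used up in
      -- `length ss + b` pays for; `b` disagreeing targets thus remain until the end.
      bal' : ∀ T → a T * edgeWeight (T s) (T t) ≡ 0 ⊎ (∀ β → length ss + b ≤ differing β R' T)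
      bal' T with bal T
      ... | inj₁ aT≡0 = inj₁ (cong (_* edgeWeight (T s) (T t)) aT≡0)
      ... | inj₂ balT = inj₂ λ β → ℕP.≤-pred (ℕP.≤-trans (balT β)
              (subst (_≤ suc (differing β R' T)) (sym (split (λ u → 𝟙 (β xor T u))))
                (ℕP.+-monoˡ-≤ (differing β R' T) (𝟙≤1 (β xor T t)))))
    ...   | ps , sources , targets , weight = (s , t) ∷ ps , cong (s ∷_) sources ,
      (λ g → subst (g t + ∑ ps (g ∘ proj₂) ≤_) (sym (split g)) (ℕP.+-monoʳ-≤ (g t) (targets g))) ,
      (begin
        4 ^ suc r * ∑ xs (λ T → a T * (edgeWeight (T s) (T t) * pairsWeight ps T))
          ≡⟨ cong (4 ^ suc r *_) (∑-cong xs λ T → sym (ℕP.*-assoc (a T) (edgeWeight (T s) (T t)) (pairsWeight ps T))) ⟩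
        4 ^ suc r * ∑ xs (λ T → a T * edgeWeight (T s) (T t) * pairsWeight ps T)
          ≡⟨ ℕP.*-assoc 4 (4 ^ r) _ ⟩
        4 * (4 ^ r * ∑ xs (λ T → a T * edgeWeight (T s) (T t) * pairsWeight ps T))
          ≤⟨ ℕP.*-monoʳ-≤ 4 weight ⟩
        4 * (c ^ r * ∑ xs (λ T → a T * edgeWeight (T s) (T t)))
          ≡⟨ swap 4 (c ^ r) _ ⟩
        c ^ r * (4 * ∑ xs (λ T → a T * edgeWeight (T s) (T t)))
          ≤⟨ ℕP.*-monoʳ-≤ (c ^ r) small ⟩
        c ^ r * (c * ∑ xs a)
          ≡⟨ rotate (c ^ r) c (∑ xs a) ⟩
        c ^ suc r * ∑ xs a ∎)
      where
      open ℕP.≤-Reasoning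
      r = length ss
      c = 4 + 3 * ν
      swap : ∀ a b c → a * (b * c) ≡ b * (a * c)
      swap = solve-∀
      rotate : ∀ a b c → a * (b * c) ≡ b * a * c
      rotate = solve-∀

-- Balanced configurations violate many links

^-≤-split : ∀ {μ d r b} → 0 < μ → μ ≤ d → r ≤ b → d ^ b ≤ 2 * μ ^ b → d ^ r ≤ 2 * μ ^ r
^-≤-split {μ} {d} {r} 0<μ μ≤d r≤b db with ℕP.m≤n⇒∃[o]m+o≡n r≤b
... | s , refl = ℕP.*-cancelʳ-≤ _ _ (μ ^ s) {{ℕP.m^n≢0 μ s {{ℕ.>-nonZero 0<μ}}}} (begin
  d ^ r * μ ^ s         ≤⟨ ℕP.*-monoʳ-≤ (d ^ r) (ℕP.^-monoˡ-≤ s μ≤d) ⟩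
  d ^ r * d ^ s         ≡⟨ sym (ℕP.^-distribˡ-+-* d r s) ⟩
  d ^ (r + s)           ≤⟨ db ⟩
  2 * μ ^ (r + s)       ≡⟨ cong (2 *_) (ℕP.^-distribˡ-+-* μ r s) ⟩
  2 * (μ ^ r * μ ^ s)   ≡⟨ sym (ℕP.*-assoc 2 (μ ^ r) (μ ^ s)) ⟩
  2 * μ ^ r * μ ^ s     ∎)
  where open ℕP.≤-Reasoning

-- The `q`-th power of `base` yields the gain `μ ^ q`. The remainder `r` costs a factor 2 by `tail`,
-- and the two constant path configurations another 2. Hence `μ ^ q ≤ 4 * μ ^ v`, and `4 < μ` leaves
-- no room for `v < q`.
compare-rates : ∀ {μ c d a b q r v} → 4 < μ → 0 < c → μ ≤ d → r ≤ b →
  μ * (c ^ a * d ^ b) ≤ 4 ^ a * μ ^ b * μ ^ a →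
  d ^ b ≤ 2 * μ ^ b →
  4 ^ (a * q) * μ ^ (b * q + r) * μ ^ (a * q) ≤ c ^ (a * q) * (2 * d ^ (b * q + r)) * μ ^ v →
  q ≤ v
compare-rates {μ} {c} {d} {a} {b} {q} {r} {v} 4<μ 0<c μ≤d r≤b base tail main = ℕP.≮⇒≥ λ v<q →
  ℕP.<-irrefl refl (begin-strict
    4 * μ ^ v     <⟨ ℕP.*-monoˡ-< (μ ^ v) 4<μ ⟩
    μ ^ suc v     ≤⟨ ℕP.^-monoʳ-≤ μ v<q ⟩
    μ ^ q         ≤⟨ μ^q≤ ⟩
    4 * μ ^ v     ∎)
  where
  open ℕP.≤-Reasoning
  0<μ : 0 < μ
  0<μ = ℕP.≤-trans (s≤s z≤n) 4<μ
  instance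
    _ = ℕ.>-nonZero 0<μ
    _ = ℕ.>-nonZero 0<c
    _ = ℕ.>-nonZero (ℕP.≤-trans 0<μ μ≤d)
    _ = ℕP.m^n≢0 μ v
    _ = ℕP.m^n≢0 μ r
  B = c ^ a * d ^ b
  instance
    _ = ℕP.m*n≢0 (c ^ a) (d ^ b) {{ℕP.m^n≢0 c a}} {{ℕP.m^n≢0 d b}}
    _ = ℕP.m^n≢0 B q
    _ = ℕP.m*n≢0 (B ^ q) (μ ^ r)
  ^-*-distrib : ∀ x y n → (x * y) ^ n ≡ x ^ n * y ^ n
  ^-*-distrib x y zero    = refl
  ^-*-distrib x y (suc n) = trans (cong (x * y *_) (^-*-distrib x y n)) (inter x y (x ^ n) (y ^ n))
    where
    inter : ∀ a b c d → a * b * (c * d) ≡ a * c * (b * d)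
    inter = solve-∀
  lhs : (4 ^ a * μ ^ b * μ ^ a) ^ q * μ ^ r ≡ 4 ^ (a * q) * μ ^ (b * q + r) * μ ^ (a * q)
  lhs = trans (cong (_* μ ^ r)
      (trans (^-*-distrib (4 ^ a * μ ^ b) (μ ^ a) q) (cong₂ _*_
        (trans (^-*-distrib (4 ^ a) (μ ^ b) q) (cong₂ _*_ (ℕP.^-*-assoc 4 a q) (ℕP.^-*-assoc μ b q)))
        (ℕP.^-*-assoc μ a q))))
    (trans (move (4 ^ (a * q)) (μ ^ (b * q)) (μ ^ (a * q)) (μ ^ r))
      (cong (λ z → 4 ^ (a * q) * z * μ ^ (a * q)) (sym (ℕP.^-distribˡ-+-* μ (b * q) r))))
    where
    move : ∀ w x y z → w * x * y * z ≡ w * (x * z) * y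
    move = solve-∀
  rhs : c ^ (a * q) * (2 * d ^ (b * q + r)) * μ ^ v ≡ B ^ q * (2 * d ^ r) * μ ^ v
  rhs = cong (_* μ ^ v) (trans
    (cong (λ z → c ^ (a * q) * (2 * z)) (ℕP.^-distribˡ-+-* d (b * q) r))
    (trans (move (c ^ (a * q)) (d ^ (b * q)) (d ^ r)) (cong (_* (2 * d ^ r))
      (sym (trans (^-*-distrib (c ^ a) (d ^ b) q) (cong₂ _*_ (ℕP.^-*-assoc c a q) (ℕP.^-*-assoc d b q)))))))
    where
    move : ∀ x y z → x * (2 * (y * z)) ≡ x * y * (2 * z)
    move = solve-∀
  μ^q≤ : μ ^ q ≤ 4 * μ ^ v
  μ^q≤ = ℕP.*-cancelʳ-≤ _ _ (B ^ q * μ ^ r) (begin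
    μ ^ q * (B ^ q * μ ^ r)          ≡⟨ sym (ℕP.*-assoc (μ ^ q) (B ^ q) (μ ^ r)) ⟩
    μ ^ q * B ^ q * μ ^ r            ≡⟨ cong (_* μ ^ r) (sym (^-*-distrib μ B q)) ⟩
    (μ * B) ^ q * μ ^ r              ≤⟨ ℕP.*-monoˡ-≤ (μ ^ r) (ℕP.^-monoˡ-≤ q base) ⟩
    (4 ^ a * μ ^ b * μ ^ a) ^ q * μ ^ r                     ≡⟨ lhs ⟩
    4 ^ (a * q) * μ ^ (b * q + r) * μ ^ (a * q)             ≤⟨ main ⟩
    c ^ (a * q) * (2 * d ^ (b * q + r)) * μ ^ v             ≡⟨ rhs ⟩
    B ^ q * (2 * d ^ r) * μ ^ v      ≤⟨ ℕP.*-monoˡ-≤ (μ ^ v) (ℕP.*-monoʳ-≤ (B ^ q)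
                                          (ℕP.*-monoʳ-≤ 2 (^-≤-split 0<μ μ≤d r≤b tail))) ⟩
    B ^ q * (2 * (2 * μ ^ r)) * μ ^ v                       ≡⟨ reorder (B ^ q) (μ ^ r) (μ ^ v) ⟩
    4 * μ ^ v * (B ^ q * μ ^ r)      ∎)
    where
    reorder : ∀ x y z → x * (2 * (2 * y)) * z ≡ 4 * z * (x * y)
    reorder = solve-∀

up : ∀ {n} → Spin n → ℕ
up {n} T = ∑ (allFin n) (λ i → 𝟙 (T i))

up-ext : ∀ {n} → Extensional (up {n})
up-ext {n} e = ∑-cong (allFin n) (λ i → cong 𝟙 (e i))

up-not : ∀ {n} (T : Spin n) → up T + up (not ∘ T) ≡ n
up-not {n} T = trans (sym (∑-+ (allFin n) _ _))
  (trans (∑-cong (allFin n) (λ i → one (T i))) (∑-fin-1 n))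
  where
  one : ∀ b → 𝟙 b + 𝟙 (not b) ≡ 1
  one true  = refl
  one false = refl

2⌊n/2⌋≤n : ∀ n → ⌊ n /2⌋ + ⌊ n /2⌋ ≤ n
2⌊n/2⌋≤n n = subst (⌊ n /2⌋ + ⌊ n /2⌋ ≤_) (ℕP.⌊n/2⌋+⌈n/2⌉≡n n) (ℕP.+-monoʳ-≤ ⌊ n /2⌋ (ℕP.⌊n/2⌋≤⌈n/2⌉ n))

n≤1+2⌊n/2⌋ : ∀ n → n ≤ suc (⌊ n /2⌋ + ⌊ n /2⌋)
n≤1+2⌊n/2⌋ zero          = z≤n
n≤1+2⌊n/2⌋ (suc zero)    = s≤s z≤n
n≤1+2⌊n/2⌋ (suc (suc n)) = s≤s (ℕP.≤-trans (s≤s (n≤1+2⌊n/2⌋ n))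
  (ℕP.≤-reflexive (cong suc (sym (ℕP.+-suc ⌊ n /2⌋ ⌊ n /2⌋)))))

-- With indicator functions g, the bounds say that the sources are distinct and the targets are distinct.
record Matching (n : ℕ) : Set where
  field
    pairs   : List (Fin n × Fin n)
    sources : ∀ g → ∑ pairs (g ∘ proj₁) ≤ ∑ (allFin n) g
    targets : ∀ g → ∑ pairs (g ∘ proj₂) ≤ ∑ (allFin n) g
noMatching : ∀ n → Matching n
noMatching n = record { pairs = [] ; sources = λ _ → z≤n ; targets = λ _ → z≤n }

open Weights 255

viol : ∀ {n} → Matching n → Spin n → ℕ
viol M T = pathViolated T + pairsViolated (Matching.pairs M) T

-- Each spin occurs about `88 * q` times, against the `66 * q + 44` required. The additive constants
-- and the off-by-one in `suc ⌊ n /2⌋` are absorbed once `q` is at least 3; the minority spin is the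
-- tight case.
balanced-differing : ∀ n q (T : Spin n) → 176 * q < n → 3 ≤ q → up T ≡ suc ⌊ n /2⌋ →
  ∀ β → 22 * q + (44 * q + 44) ≤ differing β (allFin n) T
balanced-differing n q T large 3≤q upT = λ { false → subst (_ ≤_) (sym upT) up≥ ; true → down≥ }
  where
  open ℕP.≤-Reasoning
  h = ⌊ n /2⌋
  double-cancel : ∀ {x y} → x + x ≤ y + y → x ≤ y
  double-cancel {x} {y} le = ℕP.≮⇒≥ λ y<x → ℕP.<-irrefl refl (ℕP.<-≤-trans (ℕP.+-mono-< y<x y<x) le)
  up≥ : 22 * q + (44 * q + 44) ≤ suc h
  up≥ = double-cancel (begin
    (22 * q + (44 * q + 44)) + (22 * q + (44 * q + 44))  ≡⟨ e₁ q ⟩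
    132 * q + 88                     ≤⟨ ℕP.+-monoʳ-≤ (132 * q) (ℕP.≤-trans (ℕP.m≤m+n 88 44) (ℕP.*-monoʳ-≤ 44 3≤q)) ⟩
    132 * q + 44 * q                 ≡⟨ e₂ q ⟩
    176 * q                          ≤⟨ ℕP.<⇒≤ large ⟩
    n                                ≤⟨ n≤1+2⌊n/2⌋ n ⟩
    suc (h + h)                      ≤⟨ s≤s (ℕP.+-monoʳ-≤ h (ℕP.n≤1+n h)) ⟩
    suc h + suc h                    ∎)
    where
    e₁ : ∀ q → (22 * q + (44 * q + 44)) + (22 * q + (44 * q + 44)) ≡ 132 * q + 88
    e₁ = solve-∀
    e₂ : ∀ q → 132 * q + 44 * q ≡ 176 * q
    e₂ = solve-∀
  D = up (not ∘ T)
  down≥ : 22 * q + (44 * q + 44) ≤ D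
  down≥ = double-cancel (ℕP.+-cancelˡ-≤ (h + h + 2) _ _ (begin
    (h + h + 2) + ((22 * q + (44 * q + 44)) + (22 * q + (44 * q + 44)))
      ≡⟨ cong (h + h + 2 ℕ.+_) (e₁ q) ⟩
    (h + h + 2) + (132 * q + 88)     ≡⟨ e₃ (h + h) (132 * q) ⟩
    (h + h) + (132 * q + 90)         ≤⟨ ℕP.+-mono-≤ (2⌊n/2⌋≤n n) (ℕP.+-monoʳ-≤ (132 * q)
                                          (ℕP.≤-trans (ℕP.m≤m+n 90 42) (ℕP.*-monoʳ-≤ 44 3≤q))) ⟩
    n + (132 * q + 44 * q)           ≡⟨ cong (n ℕ.+_) (e₂ q) ⟩
    n + 176 * q                      ≤⟨ ℕP.+-monoʳ-≤ n (ℕP.<⇒≤ large) ⟩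
    n + n                            ≡⟨ cong₂ _+_ n≡ n≡ ⟩
    (suc h + D) + (suc h + D)        ≡⟨ e₄ h D ⟩
    (h + h + 2) + (D + D)            ∎))
    where
    n≡ : n ≡ suc h + D
    n≡ = sym (trans (cong (_+ D) (sym upT)) (up-not T))
    e₁ : ∀ q → (22 * q + (44 * q + 44)) + (22 * q + (44 * q + 44)) ≡ 132 * q + 88
    e₁ = solve-∀
    e₂ : ∀ q → 132 * q + 44 * q ≡ 176 * q
    e₂ = solve-∀
    e₃ : ∀ x y → (x + 2) + (y + 88) ≡ x + (y + 90)
    e₃ = solve-∀
    e₄ : ∀ h d → (suc h + d) + (suc h + d) ≡ (h + h + 2) + (d + d)
    e₄ = solve-∀

-- The first 22q vertices of a path on 176q + r + 1 vertices are matched greedily; the path keeps the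
-- total weight of all configurations below 2 · 257ᵐ, so that the gain 769/1024 per matched pair wins.
expander : ∀ {m} q r → m ≡ 176 * q + r → r < 176 → 3 ≤ q →
  Σ (Matching (suc m)) λ M → ∀ T → up T ≡ suc ⌊ suc m /2⌋ → q ≤ viol M T
expander {m} q r m≡ r<176 3≤q = M , bound
  where
  n = suc m
  h = ⌊ n /2⌋
  K = 22 * q
  -- A quarter of `176 * q + 176`, which is the upper bound on `n` coming from `r < 176`.
  b = 44 * q + 44
  ss = take K (allFin n)

  large : 176 * q < n
  large = s≤s (subst (176 * q ≤_) (sym m≡) (ℕP.m≤m+n (176 * q) r))

  len-all : length (allFin n) ≡ n
  len-all = ListP.length-tabulate {n = n} (λ i → i)

  K≤n : K ≤ n
  K≤n = ℕP.≤-trans (ℕP.*-monoˡ-≤ q (ℕP.m≤m+n 22 154)) (ℕP.<⇒≤ large)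

  len-ss : length ss ≡ K
  len-ss = trans (ListP.length-take K (allFin n)) (trans (cong (K ℕ.⊓_) len-all) (ℕP.m≤n⇒m⊓n≡m K≤n))

  n≤4b : n ≤ 4 * b
  n≤4b = begin
    suc m                   ≡⟨ cong suc m≡ ⟩
    suc (176 * q + r)       ≡⟨ sym (ℕP.+-suc (176 * q) r) ⟩
    176 * q + suc r         ≤⟨ ℕP.+-monoʳ-≤ (176 * q) r<176 ⟩
    176 * q + 176           ≡⟨ e q ⟩
    4 * b                   ∎
    where
    open ℕP.≤-Reasoning
    e : ∀ q → 176 * q + 176 ≡ 4 * (44 * q + 44)
    e = solve-∀

  a : Spin n → ℕ
  a T = if up T ℕ.≡ᵇ suc h then pathWeight T else 0

  a-balanced : ∀ T → a T ≡ 0 ⊎ (∀ β → length ss + b ≤ differing β (allFin n) T)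
  a-balanced T with up T ℕ.≡ᵇ suc h in e
  ... | false = inj₁ refl
  ... | true  = inj₂ λ β → subst (λ k → k + b ≤ differing β (allFin n) T) (sym len-ss)
    (balanced-differing n q T large 3≤q (ℕP.≡ᵇ⇒≡ _ _ (true⇒T e)) β)

  matched = greedy (allSpins n) b ss (allFin n) a
    (subst₂ _≤_ (sym len-ss) (sym len-all) K≤n) (subst (_≤ 4 * b) (sym len-all) n≤4b) a-balanced
  ps = proj₁ matched

  M : Matching n
  M = record
    { pairs   = ps
    ; sources = λ g → subst (_≤ ∑ (allFin n) g)
        (trans (cong (λ xs → ∑ xs g) (sym (proj₁ (proj₂ matched)))) (∑-map proj₁ ps g))
        (∑-take-≤ K (allFin n) g)
    ; targets = proj₁ (proj₂ (proj₂ matched))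
    }

  len-ps : length ps ≡ K
  len-ps = trans (sym (ListP.length-map proj₁ ps)) (trans (cong length (proj₁ (proj₂ matched))) len-ss)

  c = 769

  total : 4 ^ K * ∑ (allSpins n) (λ T → a T * pairsWeight ps T) ≤ c ^ K * ∑ (allSpins n) a
  total = subst (λ k → 4 ^ k * ∑ (allSpins n) (λ T → a T * pairsWeight ps T) ≤ c ^ k * ∑ (allSpins n) a)
    len-ss (proj₂ (proj₂ (proj₂ matched)))

  a≤pathWeight : ∀ T → a T ≤ pathWeight T
  a≤pathWeight T with up T ℕ.≡ᵇ suc h
  ... | true  = ℕP.≤-refl
  ... | false = z≤n

  bound : ∀ T → up T ≡ suc h → q ≤ viol M T
  -- The two closed inequalities are `256 · 769²² · 257¹⁷⁶ ≤ 4²² · 256¹⁷⁶ · 256²²` and `257¹⁷⁶ ≤ 2 ·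
  -- 256¹⁷⁶`, both decided by evaluation. The second holds because 176 is just below `256 · ln 2`,
  -- and 22 matched pairs per 176 path edges make the first true by a small margin.
  bound T upT = compare-rates {μ = 256} {c = c} {d = 257} {a = 22} {b = 176} {q = q} {r = r} {v = viol M T}
    (ℕP.≤ᵇ⇒≤ _ _ tt) (s≤s z≤n) (ℕP.n≤1+n 256) (ℕP.<⇒≤ r<176) (ℕP.≤ᵇ⇒≤ _ _ tt) (ℕP.≤ᵇ⇒≤ _ _ tt)
    (subst (λ k → 4 ^ K * 256 ^ k * 256 ^ K ≤ c ^ K * (2 * 257 ^ k) * 256 ^ viol M T) m≡ main)
    where
    open ℕP.≤-Reasoning
    f : Spin n → ℕ
    f T = a T * pairsWeight ps T
    f-ext : Extensional f
    f-ext e = cong₂ _*_ (cong₂ (λ x y → if x ℕ.≡ᵇ suc h then y else 0) (up-ext e) (pathWeight-ext e))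
      (pairsWeight-ext ps e)
    aT : a T ≡ pathWeight T
    aT = cong (λ x → if x then pathWeight T else 0) (eqᵇ (up T) (suc h) upT)
      where
      eqᵇ : ∀ x y → x ≡ y → (x ℕ.≡ᵇ y) ≡ true
      eqᵇ zero    _ refl = refl
      eqᵇ (suc x) _ refl = eqᵇ x x refl
    x = pathViolated T
    y = pairsViolated ps T
    weights : f T * 256 ^ viol M T ≡ 256 ^ m * 256 ^ K
    weights = begin-equality
      a T * pairsWeight ps T * 256 ^ (x + y)
        ≡⟨ cong₂ (λ u v → u * pairsWeight ps T * v) aT (ℕP.^-distribˡ-+-* 256 x y) ⟩
      pathWeight T * pairsWeight ps T * (256 ^ x * 256 ^ y)
        ≡⟨ inter (pathWeight T) (pairsWeight ps T) (256 ^ x) (256 ^ y) ⟩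
      (pathWeight T * 256 ^ x) * (pairsWeight ps T * 256 ^ y)
        ≡⟨ cong₂ _*_ (pathWeight-^ T) (trans (pairsWeight-^ ps T) (cong (256 ^_) len-ps)) ⟩
      256 ^ m * 256 ^ K ∎
      where
      inter : ∀ a b c d → a * b * (c * d) ≡ (a * c) * (b * d)
      inter = solve-∀
    main : 4 ^ K * 256 ^ m * 256 ^ K ≤ c ^ K * (2 * 257 ^ m) * 256 ^ viol M T
    main = begin
      4 ^ K * 256 ^ m * 256 ^ K
        ≡⟨ ℕP.*-assoc (4 ^ K) (256 ^ m) (256 ^ K) ⟩
      4 ^ K * (256 ^ m * 256 ^ K)
        ≡⟨ cong (4 ^ K *_) (sym weights) ⟩
      4 ^ K * (f T * 256 ^ viol M T)
        ≡⟨ sym (ℕP.*-assoc (4 ^ K) (f T) _) ⟩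
      4 ^ K * f T * 256 ^ viol M T
        ≤⟨ ℕP.*-monoˡ-≤ (256 ^ viol M T) (begin
             4 ^ K * f T                     ≤⟨ ℕP.*-monoʳ-≤ (4 ^ K) (term≤∑-spins f-ext T) ⟩
             4 ^ K * ∑ (allSpins n) f        ≤⟨ total ⟩
             c ^ K * ∑ (allSpins n) a        ≤⟨ ℕP.*-monoʳ-≤ (c ^ K) (∑-mono (allSpins n) a≤pathWeight) ⟩
             c ^ K * ∑ (allSpins n) pathWeight ≡⟨ cong (c ^ K *_) (∑-pathWeight m) ⟩
             c ^ K * (2 * 257 ^ m)           ∎) ⟩
      c ^ K * (2 * 257 ^ m) * 256 ^ viol M T ∎

-- One period

∧-true : ∀ a b → a ∧ b ≡ true → a ≡ true × b ≡ true
∧-true true b e = refl , e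

infixr 5 _⇒_

_⇒_ : Bool → Bool → Bool
a ⇒ b = not a ∨ b

⇒-elim : ∀ {a b} → (a ⇒ b) ≡ true → a ≡ true → b ≡ true
⇒-elim e refl = e

-- Facts about one period, or about a link between two, concern finitely many labels and bits. These
-- checkers evaluate all cases, so that `refl` proves the outcome and the soundness lemmas return
-- the quantified statement.
checkBool : (Bool → Bool) → Bool
checkBool P = P true ∧ P false

checkBool-sound : ∀ P → checkBool P ≡ true → ∀ b → P b ≡ true
checkBool-sound P e true  = proj₁ (∧-true _ _ e)
checkBool-sound P e false = proj₂ (∧-true _ _ e)

checkFin : ∀ n → (Fin n → Bool) → Bool
checkFin zero    P = true
checkFin (suc n) P = P zero ∧ checkFin n (P ∘ suc)

checkFin-sound : ∀ n P → checkFin n P ≡ true → ∀ i → P i ≡ true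
checkFin-sound (suc n) P e zero    = proj₁ (∧-true _ _ e)
checkFin-sound (suc n) P e (suc i) = checkFin-sound n (P ∘ suc) (proj₂ (∧-true _ _ e)) i

checkVec : ∀ k → (Vec Bool k → Bool) → Bool
checkVec zero    P = P []
checkVec (suc k) P = checkBool (λ b → checkVec k (λ v → P (b ∷ v)))

checkVec-sound : ∀ k P → checkVec k P ≡ true → ∀ v → P v ≡ true
checkVec-sound zero    P e []      = e
checkVec-sound (suc k) P e (b ∷ v) = checkVec-sound k (λ v → P (b ∷ v))
  (checkBool-sound (λ b → checkVec k (λ v → P (b ∷ v))) e b) v

≤ᵇ-sound : ∀ {m n} → (m ≤ᵇ n) ≡ true → m ≤ n
≤ᵇ-sound {m} {n} e = ℕP.≤ᵇ⇒≤ m n (true⇒T e)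

AtMostOne : ∀ {n} → (Fin n → Bool) → Set
AtMostOne f = ∀ {j k} → f j ≡ true → f k ≡ true → j ≡ k

∑-AtMostOne : ∀ {n} (f : Fin n → Bool) → AtMostOne f → ∑ (allFin n) (λ j → 𝟙 (f j)) ≤ 1
∑-AtMostOne {zero}  f u = z≤n
∑-AtMostOne {suc n} f u = subst (_≤ 1) (sym (∑-fin-suc (λ j → 𝟙 (f j)))) (go (f zero) refl)
  where
  suc-inj : ∀ {m} {i j : Fin m} → Data.Fin.suc i ≡ suc j → i ≡ j
  suc-inj refl = refl
  rest : ∑ (allFin n) (λ j → 𝟙 (f (suc j))) ≤ 1
  rest = ∑-AtMostOne (f ∘ suc) (λ p q → suc-inj (u p q))
  go : ∀ b → f zero ≡ b → 𝟙 b + ∑ (allFin n) (λ j → 𝟙 (f (suc j))) ≤ 1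
  go false e = rest
  go true  e = s≤s (ℕP.≤-reflexive (trans (∑-cong (allFin n) others) (∑-zero (allFin n))))
    where
    others : ∀ j → 𝟙 (f (suc j)) ≡ 0
    others j with f (suc j) in e'
    ... | false = refl
    ... | true  with u e e'
    ...   | ()

length-filter-T : ∀ {X : Set} (f : X → Bool) (xs : List X) →
  length (filter (λ x → BoolP.T? (f x)) xs) ≡ ∑ xs (λ x → 𝟙 (f x))
length-filter-T f []       = refl
length-filter-T f (x ∷ xs) with f x
... | true  = cong suc (length-filter-T f xs)
... | false = length-filter-T f xs

Label : Set
Label = Fin 18

-- Within a period, labels 0–7 carry the strong product of an edge with a path on the four pairs
-- {0,1}, {2,3}, {4,5}, {6,7}, whose only maximum cuts make the pairs constant and alternating;
-- labels 8–17 are isolated.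
local : Label → Label → Bool
local a b = not (toℕ a ≡ᵇ toℕ b) ∧ (toℕ a <ᵇ 8) ∧ (toℕ b <ᵇ 8) ∧ (∣ ⌊ toℕ a /2⌋ - ⌊ toℕ b /2⌋ ∣ ≤ᵇ 1)

ground : Label → Bool
ground a = (toℕ a ≡ᵇ 2) ∨ (toℕ a ≡ᵇ 3) ∨ (toℕ a ≡ᵇ 6) ∨ (toℕ a ≡ᵇ 7)

-- Each terminal serves one kind of link: 6 leads forward and 0 backward along the path, 1 is the
-- source and 7 the target of a matched pair. Periods that are both consecutive and matched, or
-- matched in both directions, therefore get distinct edges.
between : (next prev out inn : Bool) → Label → Label → Bool
between next prev out inn a b =
  if (toℕ a ≡ᵇ 6) ∧ (toℕ b ≡ᵇ 0) then next else
  if (toℕ a ≡ᵇ 0) ∧ (toℕ b ≡ᵇ 6) then prev else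
  if (toℕ a ≡ᵇ 1) ∧ (toℕ b ≡ᵇ 7) then out else
  if (toℕ a ≡ᵇ 7) ∧ (toℕ b ≡ᵇ 1) then inn else false

inner : Label → Bool
inner a = (1 <ᵇ toℕ a) ∧ (toℕ a <ᵇ 6)

-- The threshold 4 separates the two inner pairs: an inner label groups its partner with the
-- adjacent end pair, and the other inner pair forms the second clique. The local neighbours of a
-- terminal already form one clique, so the other colour stays free for its link.
side : Label → Label → Bool
side a p = if inner a then (if toℕ a <ᵇ 4 then toℕ p <ᵇ 4 else 3 <ᵇ toℕ p) else true

localCut : (Label → Bool) → ℕ
localCut x = ∑ (allFin 18) λ a → ∑ (allFin 18) λ b → 𝟙 (local a b ∧ (x a xor x b))

-- Only the terminals are inspected, relative to the spin at 7, since links see nothing else of a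
-- period.
excited : (Label → Bool) → Bool
excited x = not ((x (# 0) xor x (# 7)) ∧ (x (# 1) xor x (# 7)) ∧ not (x (# 6) xor x (# 7)))

≡-check : ∀ a b → not (a xor b) ≡ true → a ≡ b
≡-check true  true  e = refl
≡-check false false e = refl

checkLabels : (Label → Label → Bool) → Bool
checkLabels P = checkFin 18 λ a → checkFin 18 λ b → P a b

checkLabels-sound : ∀ P → checkLabels P ≡ true → ∀ a b → P a b ≡ true
checkLabels-sound P e a = checkFin-sound 18 (P a) (checkFin-sound 18 (λ a → checkFin 18 (P a)) e a)

local-sym : ∀ a b → local a b ≡ local b a
local-sym a b = ≡-check _ _ (checkLabels-sound (λ a b → not (local a b xor local b a)) refl a b)

local-irr : ∀ a → local a a ≡ false
local-irr a = ≡-check _ _ (checkFin-sound 18 (λ a → not (local a a xor false)) refl a)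

inner-side : ∀ a p → local a p ≡ true → side a p ≡ false → inner a ≡ true
inner-side a p l s = ⇒-elim (⇒-elim
  (checkLabels-sound (λ a p → local a p ⇒ not (side a p) ⇒ inner a) refl a p) l) (cong not s)

local-clique : ∀ a p r → local a p ≡ true → local a r ≡ true → side a p ≡ side a r →
  (toℕ p ≡ᵇ toℕ r) ≡ false → local p r ≡ true
local-clique a p r lp lr s p≢r = ⇒-elim (⇒-elim (⇒-elim (⇒-elim
  (checkLabels-sound (test a) (checkFin-sound 18 (λ a → checkLabels (test a)) refl a) p r)
  lp) lr) (trans (cong (λ z → not (z xor side a r)) s) (cong not (BoolP.xor-same (side a r)))))
  (cong not p≢r)
  where
  test : Label → Label → Label → Bool
  test a p r = local a p ⇒ local a r ⇒ not (side a p xor side a r) ⇒ not (toℕ p ≡ᵇ toℕ r) ⇒ local p r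

data Between (nx pv o i : Bool) (a b : Label) : Set where
  viaNext : a ≡ # 6 → b ≡ # 0 → nx ≡ true → Between nx pv o i a b
  viaPrev : a ≡ # 0 → b ≡ # 6 → pv ≡ true → Between nx pv o i a b
  viaOut  : a ≡ # 1 → b ≡ # 7 → o  ≡ true → Between nx pv o i a b
  viaInn  : a ≡ # 7 → b ≡ # 1 → i  ≡ true → Between nx pv o i a b

is-label : ∀ {n} (a b : Fin n) → (toℕ a ≡ᵇ toℕ b) ≡ true → a ≡ b
is-label a b e = toℕ-injective (ℕP.≡ᵇ⇒≡ _ _ (true⇒T e))

between-view : ∀ {nx pv o i} a b → between nx pv o i a b ≡ true → Between nx pv o i a b
between-view a b e with (toℕ a ≡ᵇ 6) ∧ (toℕ b ≡ᵇ 0) in e₁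
... | true = viaNext (is-label a (# 6) (proj₁ (∧-true _ _ e₁))) (is-label b (# 0) (proj₂ (∧-true _ _ e₁))) e
... | false with (toℕ a ≡ᵇ 0) ∧ (toℕ b ≡ᵇ 6) in e₂
...   | true = viaPrev (is-label a (# 0) (proj₁ (∧-true _ _ e₂))) (is-label b (# 6) (proj₂ (∧-true _ _ e₂))) e
...   | false with (toℕ a ≡ᵇ 1) ∧ (toℕ b ≡ᵇ 7) in e₃
...     | true = viaOut (is-label a (# 1) (proj₁ (∧-true _ _ e₃))) (is-label b (# 7) (proj₂ (∧-true _ _ e₃))) e
...     | false with (toℕ a ≡ᵇ 7) ∧ (toℕ b ≡ᵇ 1) in e₄
...       | true = viaInn (is-label a (# 7) (proj₁ (∧-true _ _ e₄))) (is-label b (# 1) (proj₂ (∧-true _ _ e₄))) e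

between-sym : ∀ nx pv o i a b → between nx pv o i a b ≡ between pv nx i o b a
between-sym nx pv o i a b = ≡-check _ _ (checkLabels-sound (test (nx ∷ pv ∷ o ∷ i ∷ []))
  (checkVec-sound 4 (λ v → checkLabels (test v)) refl (nx ∷ pv ∷ o ∷ i ∷ [])) a b)
  where
  test : Vec Bool 4 → Label → Label → Bool
  test (nx ∷ pv ∷ o ∷ i ∷ []) a b = not (between nx pv o i a b xor between pv nx i o b a)

between-none : ∀ a b → between false false false false a b ≡ false
between-none a b = ≡-check _ _ (checkLabels-sound
  (λ a b → not (between false false false false a b xor false)) refl a b)

between-terminal : ∀ {nx pv o i} a b → between nx pv o i a b ≡ true → inner a ≡ false
between-terminal a b e with between-view a b e
... | viaNext refl _ _ = refl
... | viaPrev refl _ _ = refl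
... | viaOut  refl _ _ = refl
... | viaInn  refl _ _ = refl

∑-between : ∀ nx pv o i (x y : Label → Bool) →
  ∑ (allFin 18) (λ a → ∑ (allFin 18) λ b →
      𝟙 ((false ∨ between nx pv o i a b) ∧ (x a xor y b)))
    ≡ (𝟙 (nx ∧ (x (# 6) xor y (# 0))) + 𝟙 (o ∧ (x (# 1) xor y (# 7))))
      + (𝟙 (pv ∧ (y (# 6) xor x (# 0))) + 𝟙 (i ∧ (y (# 1) xor x (# 7))))
∑-between nx pv o i x y
  rewrite BoolP.xor-comm (y (# 6)) (x (# 0)) | BoolP.xor-comm (y (# 1)) (x (# 7)) =
  regroup (𝟙 (pv ∧ (x (# 0) xor y (# 6)))) (𝟙 (o ∧ (x (# 1) xor y (# 7))))
          (𝟙 (nx ∧ (x (# 6) xor y (# 0)))) (𝟙 (i ∧ (x (# 7) xor y (# 1))))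
  where
  regroup : ∀ p o n i → (p + 0) + ((o + 0) + ((n + 0) + ((i + 0) + 0))) ≡ (n + o) + (p + i)
  regroup = solve-∀

∑-within : ∀ (x : Label → Bool) →
  ∑ (allFin 18) (λ a → ∑ (allFin 18) λ b →
    𝟙 ((local a b ∨ between false false false false a b) ∧ (x a xor x b))) ≡ localCut x
∑-within x = refl

-- `localCut` counts ordered pairs: 24 stands for the 12 edges of a maximum cut, and a wrong
-- terminal pattern loses at least one edge. Both terms normalise to expressions in labels 0-7, so
-- `2^8` cases decide the claim and the isolated labels may be padded arbitrarily.
localCut-excited : ∀ x → localCut x + 2 * 𝟙 (excited x) ≤ 24
localCut-excited x =
  ≤ᵇ-sound (checkVec-sound 8 (λ v → energy (pad v) ≤ᵇ 24) refl (Vec.tabulate (λ i → x (i ↑ˡ 10))))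
  where
  energy : (Label → Bool) → ℕ
  energy x = localCut x + 2 * 𝟙 (excited x)
  pad : Vec Bool 8 → Label → Bool
  pad v = Vec.lookup (v Vec.++ Vec.replicate 10 false)

localCut-ground : localCut ground ≡ 24
localCut-ground = refl

-- Assembling the periods

-- Summing over ordered pairs removes the comparison of vertex numbers, which does not respect the
-- division into periods.
2*cutSize : ∀ {n} (G : Graph n) σ →
  2 * cutSize G σ ≡ ∑ (allFin n) λ u → ∑ (allFin n) λ v → 𝟙 (adj G u v ∧ (σ u xor σ v))
2*cutSize {n} G σ = begin
  2 * cutSize G σ                        ≡⟨ cong (cutSize G σ ℕ.+_) (ℕP.+-identityʳ _) ⟩
  cutSize G σ + cutSize G σ              ≡⟨ cong (cutSize G σ ℕ.+_) (∑-swap (allFin n) (allFin n) _) ⟩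
  cutSize G σ + ∑ (allFin n) (λ u → ∑ (allFin n) λ v → ordered v u)
    ≡⟨ sym (∑-+ (allFin n) _ _) ⟩
  ∑ (allFin n) (λ u → ∑ (allFin n) (ordered u) + ∑ (allFin n) λ v → ordered v u)
    ≡⟨ ∑-cong (allFin n) (λ u → trans (sym (∑-+ (allFin n) _ _)) (∑-cong (allFin n) (both u))) ⟩
  ∑ (allFin n) (λ u → ∑ (allFin n) λ v → 𝟙 (cut u v)) ∎
  where
  open ≡-Reasoning
  cut : Fin n → Fin n → Bool
  cut u v = adj G u v ∧ (σ u xor σ v)
  ordered : Fin n → Fin n → ℕ
  ordered u v = 𝟙 (does (toℕ u <? toℕ v) ∧ adj G u v ∧ (σ u xor σ v))
  cut-sym : ∀ u v → cut u v ≡ cut v u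
  cut-sym u v = cong₂ _∧_ (adj-sym G u v) (BoolP.xor-comm (σ u) (σ v))
  both : ∀ u v → ordered u v + ordered v u ≡ 𝟙 (cut u v)
  both u v with ℕP.<-cmp (toℕ u) (toℕ v)
  ... | tri< u<v _ v≮u rewrite dec-true (toℕ u <? toℕ v) u<v | dec-false (toℕ v <? toℕ u) v≮u =
    ℕP.+-identityʳ _
  ... | tri> u≮v _ v<u rewrite dec-false (toℕ u <? toℕ v) u≮v | dec-true (toℕ v <? toℕ u) v<u =
    cong 𝟙 (cut-sym v u)
  ... | tri≈ u≮v u≡v v≮u rewrite dec-false (toℕ u <? toℕ v) u≮v | dec-false (toℕ v <? toℕ u) v≮u
    | toℕ-injective u≡v | adj-irr G v = refl

2*cutSize-blocks : ∀ m {n} (G : Graph (m * n)) (A : (v w : Fin m × Fin n) → Bool) →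
  (∀ u v → adj G u v ≡ A (remQuot n u) (remQuot n v)) → ∀ σ →
  2 * cutSize G σ
    ≡ ∑ (allFin n) λ i → ∑ (allFin n) λ j → ∑ (allFin m) λ a → ∑ (allFin m) λ b →
        𝟙 (A (a , i) (b , j) ∧ (σ (combine a i) xor σ (combine b j)))
2*cutSize-blocks m {n} G A adj≡ σ = begin
  2 * cutSize G σ
    ≡⟨ 2*cutSize G σ ⟩
  ∑ (allFin (m * n)) (λ u → ∑ (allFin (m * n)) (cut u))
    ≡⟨ ∑-combine m n (λ u → ∑ (allFin (m * n)) (cut u)) ⟩
  ∑ (allFin m) (λ a → ∑ (allFin n) λ i → ∑ (allFin (m * n)) (cut (combine a i)))
    ≡⟨ ∑-swap (allFin m) (allFin n) _ ⟩
  ∑ (allFin n) (λ i → ∑ (allFin m) λ a → ∑ (allFin (m * n)) (cut (combine a i)))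
    ≡⟨ ∑-cong (allFin n) (λ i → ∑-cong (allFin m) λ a →
         trans (∑-combine m n (cut (combine a i))) (∑-swap (allFin m) (allFin n) _)) ⟩
  ∑ (allFin n) (λ i → ∑ (allFin m) λ a → ∑ (allFin n) λ j → ∑ (allFin m) λ b →
    cut (combine a i) (combine b j))
    ≡⟨ ∑-cong (allFin n) (λ i → ∑-swap (allFin m) (allFin n) _) ⟩
  ∑ (allFin n) (λ i → ∑ (allFin n) λ j → ∑ (allFin m) λ a → ∑ (allFin m) λ b →
    cut (combine a i) (combine b j))
    ≡⟨ ∑-cong (allFin n) (λ i → ∑-cong (allFin n) λ j → ∑-cong (allFin m) λ a → ∑-cong (allFin m) λ b →
         cong (λ e → 𝟙 (e ∧ (σ (combine a i) xor σ (combine b j))))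
           (trans (adj≡ (combine a i) (combine b j)) (cong₂ A (remQuot-combine a i) (remQuot-combine b j)))) ⟩
  ∑ (allFin n) (λ i → ∑ (allFin n) λ j → ∑ (allFin m) λ a → ∑ (allFin m) λ b →
    𝟙 (A (a , i) (b , j) ∧ (σ (combine a i) xor σ (combine b j)))) ∎
  where
  open ≡-Reasoning
  cut : Fin (m * n) → Fin (m * n) → ℕ
  cut u v = 𝟙 (adj G u v ∧ (σ u xor σ v))

link-check : ∀ p q x₀ x₁ x₆ x₇ y₀ y₁ y₆ y₇ →
  let bx = 𝟙 (not ((x₀ xor x₇) ∧ (x₁ xor x₇) ∧ not (x₆ xor x₇)))
      by = 𝟙 (not ((y₀ xor y₇) ∧ (y₁ xor y₇) ∧ not (y₆ xor y₇)))
  in (𝟙 (p ∧ (x₆ xor y₀)) + 𝟙 (q ∧ (x₁ xor y₇))) + (𝟙 (p ∧ (x₇ xor y₇)) + 𝟙 (q ∧ (x₇ xor y₇)))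
     ≤ (𝟙 p + 𝟙 q) + ((𝟙 p * bx + 𝟙 p * by) + 𝟙 q * bx)
link-check p q x₀ x₁ x₆ x₇ y₀ y₁ y₆ y₇ = ≤ᵇ-sound (checkVec-sound 10 test refl
  (p ∷ q ∷ x₀ ∷ x₁ ∷ x₆ ∷ x₇ ∷ y₀ ∷ y₁ ∷ y₆ ∷ y₇ ∷ []))
  where
  test : Vec Bool 10 → Bool
  test (p ∷ q ∷ x₀ ∷ x₁ ∷ x₆ ∷ x₇ ∷ y₀ ∷ y₁ ∷ y₆ ∷ y₇ ∷ []) =
    (𝟙 (p ∧ (x₆ xor y₀)) + 𝟙 (q ∧ (x₁ xor y₇))) + (𝟙 (p ∧ (x₇ xor y₇)) + 𝟙 (q ∧ (x₇ xor y₇)))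
    ≤ᵇ (𝟙 p + 𝟙 q) + ((𝟙 p * bx + 𝟙 p * by) + 𝟙 q * bx)
    where
    bx = 𝟙 (not ((x₀ xor x₇) ∧ (x₁ xor x₇) ∧ not (x₆ xor x₇)))
    by = 𝟙 (not ((y₀ xor y₇) ∧ (y₁ xor y₇) ∧ not (y₆ xor y₇)))

-- Excitations help to hide violations (`3 * B`) but cost cut edges (`2 * B` in the doubled count).
-- Three times the local bound plus twice the link bound cancels `B`; the remaining four copies of
-- `Y` are bounded by `Y≤L`.
combine-gap : ∀ {c c₀ X X₀ Y L V B} → 2 * c ≡ X + 2 * Y → 2 * c₀ ≡ X₀ + 2 * L →
  X + 2 * B ≤ X₀ → Y + V ≤ L + 3 * B → Y ≤ L → 3 * c + V ≤ 3 * c₀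
combine-gap {c} {c₀} {X} {X₀} {Y} {L} {V} {B} cut≡ cut₀≡ local≤ links≤ Y≤L =
  ℕP.*-cancelˡ-≤ 2 (ℕP.+-cancelʳ-≤ (6 * B) _ _ (begin
    2 * (3 * c + V) + 6 * B                 ≡⟨ e₁ c V B ⟩
    3 * (2 * c) + 2 * V + 6 * B             ≡⟨ cong (λ z → 3 * z + 2 * V + 6 * B) cut≡ ⟩
    3 * (X + 2 * Y) + 2 * V + 6 * B         ≡⟨ e₂ X Y V B ⟩
    3 * (X + 2 * B) + 2 * (Y + V) + 4 * Y   ≤⟨ ℕP.+-mono-≤ (ℕP.+-mono-≤
                                                 (ℕP.*-monoʳ-≤ 3 local≤) (ℕP.*-monoʳ-≤ 2 links≤))
                                                 (ℕP.*-monoʳ-≤ 4 Y≤L) ⟩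
    3 * X₀ + 2 * (L + 3 * B) + 4 * L        ≡⟨ e₃ X₀ L B ⟩
    3 * (X₀ + 2 * L) + 6 * B                ≡⟨ cong (λ z → 3 * z + 6 * B) (sym cut₀≡) ⟩
    3 * (2 * c₀) + 6 * B                    ≡⟨ e₄ c₀ B ⟩
    2 * (3 * c₀) + 6 * B                    ∎))
  where
  open ℕP.≤-Reasoning
  e₁ : ∀ c v b → 2 * (3 * c + v) + 6 * b ≡ 3 * (2 * c) + 2 * v + 6 * b
  e₁ = solve-∀
  e₂ : ∀ x y v b → 3 * (x + 2 * y) + 2 * v + 6 * b ≡ 3 * (x + 2 * b) + 2 * (y + v) + 4 * y
  e₂ = solve-∀
  e₃ : ∀ x l b → 3 * x + 2 * (l + 3 * b) + 4 * l ≡ 3 * (x + 2 * l) + 6 * b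
  e₃ = solve-∀
  e₄ : ∀ c b → 3 * (2 * c) + 6 * b ≡ 2 * (3 * c) + 6 * b
  e₄ = solve-∀

∑∑-cong : ∀ {X Y : Set} (xs : List X) (ys : List Y) {f g : X → Y → ℕ} → (∀ x y → f x y ≡ g x y) →
  ∑ xs (λ x → ∑ ys (f x)) ≡ ∑ xs (λ x → ∑ ys (g x))
∑∑-cong xs ys e = ∑-cong xs λ x → ∑-cong ys (e x)

localCut-ext : ∀ {x y : Label → Bool} → (∀ a → x a ≡ y a) → localCut x ≡ localCut y
localCut-ext {x} {y} e = ∑∑-cong (allFin 18) (allFin 18)
  {λ a b → 𝟙 (local a b ∧ (x a xor x b))} {λ a b → 𝟙 (local a b ∧ (y a xor y b))}
  (λ a b → cong₂ (λ p q → 𝟙 (local a b ∧ (p xor q))) (e a) (e b))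

module Periods {n} (nx out : Fin n → Fin n → Bool)
  (nx-irr : ∀ i → nx i i ≡ false) (out-irr : ∀ i → out i i ≡ false)
  (nx-row : ∀ i → AtMostOne (nx i)) (nx-col : ∀ j → AtMostOne (λ i → nx i j))
  (out-row : ∀ i → AtMostOne (out i)) (out-col : ∀ j → AtMostOne (λ i → out i j))
  where

  private
    ns = allFin n
    ls = allFin 18

  links : Fin n → Fin n → Label → Label → Bool
  links i j = between (nx i j) (nx j i) (out i j) (out j i)

  adjᵖ : (v w : Label × Fin n) → Bool
  adjᵖ (a , i) (b , j) = (does (i ≟ j) ∧ local a b) ∨ links i j a b

  links-self : ∀ i a b → links i i a b ≡ false
  links-self i a b rewrite nx-irr i | out-irr i = between-none a b

  adjᵖ-same : ∀ i a b → adjᵖ (a , i) (b , i) ≡ local a b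
  adjᵖ-same i a b rewrite dec-true (i ≟ i) refl | links-self i a b = BoolP.∨-identityʳ (local a b)

  coord : Fin (18 * n) → Label × Fin n
  coord = remQuot n

  G : Graph (18 * n)
  G .adj u v = adjᵖ (coord u) (coord v)
  G .adj-sym u v = symᵖ (coord u) (coord v)
    where
    symᵖ : ∀ v w → adjᵖ v w ≡ adjᵖ w v
    symᵖ (a , i) (b , j) with i ≟ j
    ... | yes refl rewrite dec-true (i ≟ i) refl =
      cong₂ _∨_ (local-sym a b) (between-sym (nx i i) (nx i i) (out i i) (out i i) a b)
    ... | no i≢j rewrite dec-false (j ≟ i) (λ e → i≢j (sym e)) =
      between-sym (nx i j) (nx j i) (out i j) (out j i) a b
  G .adj-irr v = trans (adjᵖ-same (proj₂ (coord v)) (proj₁ (coord v)) (proj₁ (coord v)))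
    (local-irr (proj₁ (coord v)))

  -- The label of a terminal fixes the kind of link, and both relations are partial injections. A
  -- clique made of links is thus a single vertex.
  unique-link : ∀ {a i p j r k} → links i j a p ≡ true → links i k a r ≡ true → (p , j) ≡ (r , k)
  unique-link {a} {i} {p} {j} {r} {k} e e' with between-view a p e | between-view a r e'
  ... | viaNext refl refl x | viaNext _ refl y = cong (_ ,_) (nx-row i x y)
  ... | viaPrev refl refl x | viaPrev _ refl y = cong (_ ,_) (nx-col i x y)
  ... | viaOut  refl refl x | viaOut  _ refl y = cong (_ ,_) (out-row i x y)
  ... | viaInn  refl refl x | viaInn  _ refl y = cong (_ ,_) (out-col i x y)
  ... | viaNext refl _ _ | viaPrev () _ _
  ... | viaNext refl _ _ | viaOut  () _ _
  ... | viaNext refl _ _ | viaInn  () _ _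
  ... | viaPrev refl _ _ | viaNext () _ _
  ... | viaPrev refl _ _ | viaOut  () _ _
  ... | viaPrev refl _ _ | viaInn  () _ _
  ... | viaOut  refl _ _ | viaNext () _ _
  ... | viaOut  refl _ _ | viaPrev () _ _
  ... | viaOut  refl _ _ | viaInn  () _ _
  ... | viaInn  refl _ _ | viaNext () _ _
  ... | viaInn  refl _ _ | viaPrev () _ _
  ... | viaInn  refl _ _ | viaOut  () _ _

  coord-injective : ∀ u w → coord u ≡ coord w → u ≡ w
  coord-injective u w e = trans (sym (combine-remQuot n u))
    (trans (cong (λ { (a , i) → combine a i }) e) (combine-remQuot n w))

  -- One clique of the neighbourhood of v lies in the period of v; links give the other clique
  -- of a terminal, and side splits the neighbourhood of an inner label.
  quasiLine : QuasiLine G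
  quasiLine v = (λ u → inSide (coord v) (coord u)) ,
    (λ u w eu ew u≢w → near-clique (coord v) (coord u) (coord w) eu ew (u≢w ∘ coord-injective u w)) ,
    (λ u w eu ew u≢w → far-clique (coord v) (coord u) (coord w) eu ew (u≢w ∘ coord-injective u w))
    where
    inSide : (v u : Label × Fin n) → Bool
    inSide (a , i) (p , j) = does (i ≟ j) ∧ side a p
    ≢⇒≡ᵇ : ∀ {i : Fin n} {p r : Label} → (p , i) ≢ (r , i) → (toℕ p ≡ᵇ toℕ r) ≡ false
    ≢⇒≡ᵇ {p = p} {r} ne with toℕ p ≡ᵇ toℕ r in e
    ... | false = refl
    ... | true  = contradiction (cong (_, _) (is-label p r e)) ne
    near-clique : ∀ v u w → adjᵖ v u ∧ inSide v u ≡ true → adjᵖ v w ∧ inSide v w ≡ true →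
      u ≢ w → adjᵖ u w ≡ true
    near-clique (a , i) (p , j) (r , k) eu ew u≢w
      with i ≟ j | i ≟ k
    ... | no _ | _ = contradiction (proj₂ (∧-true (links i j a p) _ eu)) λ ()
    ... | yes _ | no _ = contradiction (proj₂ (∧-true (links i k a r) _ ew)) λ ()
    ... | yes refl | yes refl = trans (adjᵖ-same i p r) (local-clique a p r
      (loc p (proj₁ (∧-true _ _ eu))) (loc r (proj₁ (∧-true _ _ ew)))
      (trans (proj₂ (∧-true (local a p ∨ links i i a p) _ eu))
        (sym (proj₂ (∧-true (local a r ∨ links i i a r) _ ew))))
      (≢⇒≡ᵇ u≢w))
      where
      loc : ∀ p → local a p ∨ links i i a p ≡ true → local a p ≡ true
      loc p e rewrite links-self i a p = trans (sym (BoolP.∨-identityʳ (local a p))) e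
    far : ∀ a i p → (local a p ∨ links i i a p) ∧ not (side a p) ≡ true →
      local a p ≡ true × side a p ≡ false
    far a i p e rewrite links-self i a p | BoolP.∨-identityʳ (local a p) =
      proj₁ (∧-true _ _ e) , BoolP.not-injective (proj₂ (∧-true (local a p) _ e))
    inner-far : ∀ a i p → (local a p ∨ links i i a p) ∧ not (side a p) ≡ true → inner a ≡ true
    inner-far a i p e = let l , s = far a i p e in inner-side a p l s
    far-clique : ∀ v u w → adjᵖ v u ∧ not (inSide v u) ≡ true → adjᵖ v w ∧ not (inSide v w) ≡ true →
      u ≢ w → adjᵖ u w ≡ true
    far-clique (a , i) (p , j) (r , k) eu ew u≢w
      with i ≟ j | i ≟ k
    ... | no _ | no _ = contradiction
      (unique-link {a} {i} (proj₁ (∧-true _ _ eu)) (proj₁ (∧-true _ _ ew))) u≢w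
    ... | no _ | yes refl = contradiction (trans (sym (inner-far a i r ew))
      (between-terminal a p (proj₁ (∧-true _ _ eu)))) λ ()
    ... | yes refl | no _ = contradiction (trans (sym (inner-far a i p eu))
      (between-terminal a r (proj₁ (∧-true _ _ ew)))) λ ()
    ... | yes refl | yes refl = trans (adjᵖ-same i p r) (local-clique a p r
      (proj₁ (far a i p eu)) (proj₁ (far a i r ew))
      (trans (proj₂ (far a i p eu)) (sym (proj₂ (far a i r ew)))) (≢⇒≡ᵇ u≢w))

  localDegree : Label → ℕ
  localDegree a = ∑ ls (λ b → 𝟙 (local a b))

  linkDegree : (p q r s : Bool) → Label → ℕ
  linkDegree p q r s a = ∑ ls (λ b → 𝟙 (between p q r s a b))

  linkDegree-≤ : ∀ p q r s a →
    linkDegree p q r s a ≤ 𝟙 (not (inner a)) * (𝟙 p + 𝟙 q + 𝟙 r + 𝟙 s)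
  linkDegree-≤ p q r s a = ≤ᵇ-sound (checkFin-sound 18 (test (p ∷ q ∷ r ∷ s ∷ []))
    (checkVec-sound 4 (λ v → checkFin 18 (test v)) refl (p ∷ q ∷ r ∷ s ∷ [])) a)
    where
    test : Vec Bool 4 → Label → Bool
    test (p ∷ q ∷ r ∷ s ∷ []) a =
      linkDegree p q r s a ≤ᵇ 𝟙 (not (inner a)) * (𝟙 p + 𝟙 q + 𝟙 r + 𝟙 s)

  maxDegree : MaxDegreeAtMost G 8
  maxDegree v = subst (_≤ 8) (sym (trans (length-filter-T (adj G v) (allFin (18 * n)))
    (∑-combine 18 n _))) (bound (coord v))
    where
    open ℕP.≤-Reasoning
    four : ∀ i → ∑ ns (λ j → 𝟙 (nx i j) + 𝟙 (nx j i) + 𝟙 (out i j) + 𝟙 (out j i)) ≤ 4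
    four i = begin
      ∑ ns (λ j → 𝟙 (nx i j) + 𝟙 (nx j i) + 𝟙 (out i j) + 𝟙 (out j i))
        ≡⟨ trans (∑-+ ns _ _) (cong (_+ ∑ ns (λ j → 𝟙 (out j i)))
             (trans (∑-+ ns _ _) (cong (_+ ∑ ns (λ j → 𝟙 (out i j))) (∑-+ ns _ _)))) ⟩
      ∑ ns (λ j → 𝟙 (nx i j)) + ∑ ns (λ j → 𝟙 (nx j i))
        + ∑ ns (λ j → 𝟙 (out i j)) + ∑ ns (λ j → 𝟙 (out j i))
        ≤⟨ ℕP.+-mono-≤ (ℕP.+-mono-≤ (ℕP.+-mono-≤
             (∑-AtMostOne _ (nx-row i)) (∑-AtMostOne _ (nx-col i)))
             (∑-AtMostOne _ (out-row i))) (∑-AtMostOne _ (out-col i)) ⟩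
      4 ∎
    bound : ∀ v → ∑ ls (λ b → ∑ ns λ j → 𝟙 (adjᵖ v (coord (combine b j)))) ≤ 8
    bound (a , i) = begin
      ∑ ls (λ b → ∑ ns λ j → 𝟙 (adjᵖ (a , i) (coord (combine b j))))
        ≡⟨ ∑-cong ls (λ b → ∑-cong ns λ j → cong (λ w → 𝟙 (adjᵖ (a , i) w)) (remQuot-combine b j)) ⟩
      ∑ ls (λ b → ∑ ns λ j → 𝟙 (adjᵖ (a , i) (b , j)))
        ≤⟨ ∑-mono ls (λ b → ∑-mono ns (λ j → split b j)) ⟩
      ∑ ls (λ b → ∑ ns λ j → (if does (i ≟ j) then 𝟙 (local a b) else 0) + 𝟙 (links i j a b))
        ≡⟨ ∑-cong ls (λ b → trans (∑-+ ns _ _)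
             (cong (_+ ∑ ns (λ j → 𝟙 (links i j a b))) (∑-fin-δ i (λ _ → 𝟙 (local a b))))) ⟩
      ∑ ls (λ b → 𝟙 (local a b) + ∑ ns (λ j → 𝟙 (links i j a b)))
        ≡⟨ trans (∑-+ ls (λ b → 𝟙 (local a b)) (λ b → ∑ ns λ j → 𝟙 (links i j a b)))
             (cong (localDegree a ℕ.+_) (∑-swap ls ns (λ b j → 𝟙 (links i j a b)))) ⟩
      localDegree a + ∑ ns (λ j → linkDegree (nx i j) (nx j i) (out i j) (out j i) a)
        ≤⟨ ℕP.+-monoʳ-≤ (localDegree a) (∑-mono ns λ j →
             linkDegree-≤ (nx i j) (nx j i) (out i j) (out j i) a) ⟩
      localDegree a + ∑ ns (λ j → 𝟙 (not (inner a)) * (𝟙 (nx i j) + 𝟙 (nx j i) + 𝟙 (out i j) + 𝟙 (out j i)))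
        ≡⟨ cong (localDegree a ℕ.+_) (∑-*ˡ ns (𝟙 (not (inner a))) _) ⟩
      localDegree a + 𝟙 (not (inner a)) * ∑ ns (λ j → 𝟙 (nx i j) + 𝟙 (nx j i) + 𝟙 (out i j) + 𝟙 (out j i))
        ≤⟨ ℕP.+-monoʳ-≤ (localDegree a) (ℕP.*-monoʳ-≤ (𝟙 (not (inner a))) (four i)) ⟩
      -- Inner labels have five local neighbours and no links; labels 0, 1, 6 and 7 have three local
      -- neighbours and are charged all four kinds of link, although each carries only one.
      localDegree a + 𝟙 (not (inner a)) * 4
        ≤⟨ ≤ᵇ-sound (checkFin-sound 18 (λ a → localDegree a + 𝟙 (not (inner a)) * 4 ≤ᵇ 8) refl a) ⟩
      8 ∎
      where
      split : ∀ b j → 𝟙 (adjᵖ (a , i) (b , j))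
        ≤ (if does (i ≟ j) then 𝟙 (local a b) else 0) + 𝟙 (links i j a b)
      split b j with does (i ≟ j)
      ... | false = ℕP.≤-refl
      ... | true with local a b
      ...   | true  = s≤s z≤n
      ...   | false = ℕP.≤-refl

  linkCount : ℕ
  linkCount = ∑ ns λ i → ∑ ns λ j → 𝟙 (nx i j) + 𝟙 (out i j)

  period : Spin (18 * n) → Fin n → Label → Bool
  period σ i a = σ (combine a i)

  module _ (x : Fin n → Label → Bool) where

    linkCut : Fin n → Fin n → ℕ
    linkCut i j = 𝟙 (nx i j ∧ (x i (# 6) xor x j (# 0)))
                + 𝟙 (out i j ∧ (x i (# 1) xor x j (# 7)))

    blockCut : ∀ i j → ∑ ls (λ a → ∑ ls λ b → 𝟙 (adjᵖ (a , i) (b , j) ∧ (x i a xor x j b)))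
      ≡ (if does (i ≟ j) then localCut (x i) else 0) + (linkCut i j + linkCut j i)
    blockCut i j with i ≟ j
    ... | yes refl rewrite nx-irr i | out-irr i =
      trans (∑-within (x i)) (sym (ℕP.+-identityʳ _))
    ... | no _ = ∑-between (nx i j) (nx j i) (out i j) (out j i) (x i) (x j)

    spin : Spin n
    spin i = x i (# 7)

    bad : Fin n → ℕ
    bad i = 𝟙 (excited (x i))

    violated : ℕ
    violated = ∑ ns λ i → ∑ ns λ j → 𝟙 (nx i j ∧ (spin i xor spin j)) + 𝟙 (out i j ∧ (spin i xor spin j))

    -- In an unexcited period the terminals 0 and 1 carry the negation of the spin and the terminal 6
    -- carries the spin, so a violated link is uncut unless an excited period touches it.
    link-bound : ∀ i j →
      linkCut i j + (𝟙 (nx i j ∧ (spin i xor spin j)) + 𝟙 (out i j ∧ (spin i xor spin j)))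
      ≤ (𝟙 (nx i j) + 𝟙 (out i j)) + ((𝟙 (nx i j) * bad i + 𝟙 (nx i j) * bad j) + 𝟙 (out i j) * bad i)
    link-bound i j = link-check
      (nx i j) (out i j) (x i (# 0)) (x i (# 1)) (x i (# 6)) (x i (# 7))
      (x j (# 0)) (x j (# 1)) (x j (# 6)) (x j (# 7))

    ∑-row-≤ : ∀ (M : Fin n → Fin n → Bool) (f : Fin n → ℕ) → (∀ i → AtMostOne (M i)) →
      ∑ ns (λ i → ∑ ns λ j → 𝟙 (M i j) * f i) ≤ ∑ ns f
    ∑-row-≤ M f row = ∑-mono ns λ i → begin
      ∑ ns (λ j → 𝟙 (M i j) * f i)   ≡⟨ ∑-*ʳ ns (f i) (λ j → 𝟙 (M i j)) ⟩
      ∑ ns (λ j → 𝟙 (M i j)) * f i   ≤⟨ ℕP.*-monoˡ-≤ (f i) (∑-AtMostOne (M i) (row i)) ⟩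
      1 * f i                        ≡⟨ ℕP.*-identityˡ (f i) ⟩
      f i                            ∎
      where open ℕP.≤-Reasoning

    -- An excited period can spoil three links: its two path links and the matched link that leaves
    -- it. The matched link that enters it ends at label 7, which by definition shows the spin.
    links-bound : ∑ ns (λ i → ∑ ns (linkCut i)) + violated ≤ linkCount + 3 * ∑ ns bad
    links-bound = begin
      ∑ ns (λ i → ∑ ns (linkCut i)) + violated
        ≡⟨ sym (trans (∑-cong ns λ i → ∑-+ ns (linkCut i) (slack i)) (∑-+ ns _ _)) ⟩
      ∑ ns (λ i → ∑ ns λ j → linkCut i j + slack i j)
        ≤⟨ ∑-mono ns (λ i → ∑-mono ns (link-bound i)) ⟩
      ∑ ns (λ i → ∑ ns λ j → (𝟙 (nx i j) + 𝟙 (out i j)) + ((B₁ i j + B₂ i j) + B₃ i j))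
        ≡⟨ trans (∑-cong ns λ i → trans (∑-+ ns _ _) (cong (∑ ns (λ j → 𝟙 (nx i j) + 𝟙 (out i j)) ℕ.+_)
             (trans (∑-+ ns _ _) (cong (_+ ∑ ns (B₃ i)) (∑-+ ns _ _)))))
           (trans (∑-+ ns _ _) (cong (linkCount ℕ.+_) (trans (∑-+ ns _ _)
             (cong (_+ ∑ ns (λ i → ∑ ns (B₃ i))) (∑-+ ns _ _))))) ⟩
      linkCount + ((∑ ns (λ i → ∑ ns (B₁ i)) + ∑ ns (λ i → ∑ ns (B₂ i))) + ∑ ns (λ i → ∑ ns (B₃ i)))
        ≤⟨ ℕP.+-monoʳ-≤ linkCount (ℕP.+-mono-≤ (ℕP.+-mono-≤ (∑-row-≤ nx bad nx-row)
             (subst (_≤ ∑ ns bad) (∑-swap ns ns (λ j i → 𝟙 (nx i j) * bad j))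
               (∑-row-≤ (λ j i → nx i j) bad nx-col)))
             (∑-row-≤ out bad out-row)) ⟩
      linkCount + ((∑ ns bad + ∑ ns bad) + ∑ ns bad)
        ≡⟨ cong (linkCount ℕ.+_) (triple (∑ ns bad)) ⟩
      linkCount + 3 * ∑ ns bad ∎
      where
      open ℕP.≤-Reasoning
      slack B₁ B₂ B₃ : Fin n → Fin n → ℕ
      slack i j = 𝟙 (nx i j ∧ (spin i xor spin j)) + 𝟙 (out i j ∧ (spin i xor spin j))
      B₁ i j = 𝟙 (nx i j) * bad i
      B₂ i j = 𝟙 (nx i j) * bad j
      B₃ i j = 𝟙 (out i j) * bad i
      triple : ∀ x → (x + x) + x ≡ 3 * x
      triple = solve-∀

    linkCut-≤ : ∑ ns (λ i → ∑ ns (linkCut i)) ≤ linkCount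
    linkCut-≤ = ∑-mono ns λ i → ∑-mono ns λ j → ℕP.+-mono-≤ (𝟙-∧-≤ (nx i j)) (𝟙-∧-≤ (out i j))
      where
      𝟙-∧-≤ : ∀ a {b} → 𝟙 (a ∧ b) ≤ 𝟙 a
      𝟙-∧-≤ true  {b} = 𝟙≤1 b
      𝟙-∧-≤ false     = z≤n

    local-bound : ∑ ns (λ i → localCut (x i)) + 2 * ∑ ns bad ≤ ∑ ns (λ _ → 24)
    local-bound = subst (_≤ ∑ ns (λ _ → 24))
      (trans (∑-+ ns _ _) (cong (∑ ns (λ i → localCut (x i)) ℕ.+_) (∑-*ˡ ns 2 bad)))
      (∑-mono ns λ i → localCut-excited (x i))

    linkCut-ground : (∀ i a → x i a ≡ ground a) → ∑ ns (λ i → ∑ ns (linkCut i)) ≡ linkCount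
    linkCut-ground x≡ = ∑∑-cong ns ns {linkCut} λ i j →
      cong₂ _+_ (full (nx i j) (x≡ i (# 6)) (x≡ j (# 0))) (full (out i j) (x≡ i (# 1)) (x≡ j (# 7)))
      where
      full : ∀ m {p q b} → p ≡ b → q ≡ not b → 𝟙 (m ∧ (p xor q)) ≡ 𝟙 m
      full m {b = true}  refl refl = cong 𝟙 (BoolP.∧-identityʳ m)
      full m {b = false} refl refl = cong 𝟙 (BoolP.∧-identityʳ m)

  2*cutSize-periods : ∀ σ → 2 * cutSize G σ
    ≡ ∑ ns (λ i → localCut (period σ i)) + 2 * ∑ ns (λ i → ∑ ns (linkCut (period σ) i))
  2*cutSize-periods σ = begin
    2 * cutSize G σ
      ≡⟨ 2*cutSize-blocks 18 G adjᵖ (λ _ _ → refl) σ ⟩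
    ∑ ns (λ i → ∑ ns λ j → ∑ ls λ a → ∑ ls λ b → 𝟙 (adjᵖ (a , i) (b , j) ∧ (period σ i a xor period σ j b)))
      ≡⟨ ∑-cong ns (λ i → ∑-cong ns (blockCut (period σ) i)) ⟩
    ∑ ns (λ i → ∑ ns λ j → own i j + (linkCut (period σ) i j + linkCut (period σ) j i))
      ≡⟨ ∑-cong ns (λ i → trans (∑-+ ns (own i) (λ j → linkCut (period σ) i j + linkCut (period σ) j i))
           (cong₂ _+_ (∑-fin-δ i (λ _ → localCut (period σ i))) (∑-+ ns (linkCut (period σ) i) (λ j → linkCut (period σ) j i)))) ⟩
    ∑ ns (λ i → localCut (period σ i) + (∑ ns (linkCut (period σ) i) + ∑ ns (λ j → linkCut (period σ) j i)))
      ≡⟨ trans (∑-+ ns _ _) (cong (∑ ns (λ i → localCut (period σ i)) ℕ.+_) (∑-+ ns _ _)) ⟩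
    ∑ ns (λ i → localCut (period σ i)) + (Y + ∑ ns (λ i → ∑ ns (λ j → linkCut (period σ) j i)))
      ≡⟨ cong (λ z → ∑ ns (λ i → localCut (period σ i)) + (Y + z))
           (trans (∑-swap ns ns (λ i j → linkCut (period σ) j i)) (sym (ℕP.+-identityʳ Y))) ⟩
    ∑ ns (λ i → localCut (period σ i)) + 2 * Y ∎
    where
    open ≡-Reasoning
    Y : ℕ
    Y = ∑ ns (λ i → ∑ ns (linkCut (period σ) i))
    own : Fin n → Fin n → ℕ
    own i j = if does (i ≟ j) then localCut (period σ i) else 0

  groundState : Spin (18 * n)
  groundState u = ground (proj₁ (coord u))

  period-ground : ∀ i a → period groundState i a ≡ ground a
  period-ground i a = cong (λ v → ground (proj₁ v)) (remQuot-combine a i)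

  2*cutSize-ground : 2 * cutSize G groundState ≡ ∑ ns (λ _ → 24) + 2 * linkCount
  2*cutSize-ground = trans (2*cutSize-periods groundState) (cong₂ (λ x y → x + 2 * y)
    (∑-cong ns λ i → trans (localCut-ext (period-ground i)) localCut-ground)
    (linkCut-ground (period groundState) period-ground))

  energy-gap : ∀ σ → 3 * cutSize G σ + violated (period σ) ≤ 3 * cutSize G groundState
  energy-gap σ = combine-gap {c = cutSize G σ} {c₀ = cutSize G groundState}
    {X = ∑ ns (λ i → localCut (period σ i))} {Y = ∑ ns (λ i → ∑ ns (linkCut (period σ) i))}
    {B = ∑ ns (bad (period σ))}
    (2*cutSize-periods σ) 2*cutSize-ground
    (local-bound (period σ)) (links-bound (period σ)) (linkCut-≤ (period σ))

-- The path and the matching as Boolean relations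

module _ {n : ℕ} where

  private
    ns = allFin n

  δ : Fin n → Fin n → ℕ
  δ i j = 𝟙 (does (i ≟ j))

  ∑-δ-* : ∀ i (f : Fin n → ℕ) → ∑ ns (λ j → δ i j * f j) ≡ f i
  ∑-δ-* i f = trans (∑-cong ns (λ j → 𝟙-* (does (i ≟ j)) (f j))) (∑-fin-δ i f)
    where
    𝟙-* : ∀ b x → 𝟙 b * x ≡ (if b then x else 0)
    𝟙-* true  x = ℕP.*-identityˡ x
    𝟙-* false x = refl

  ∑-δ : ∀ i → ∑ ns (δ i) ≡ 1
  ∑-δ i = ∑-fin-δ i (λ _ → 1)

  δ-sym : ∀ i j → δ i j ≡ δ j i
  δ-sym i j with i ≟ j
  ... | yes refl = cong 𝟙 (sym (dec-true (i ≟ i) refl))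
  ... | no i≢j   = cong 𝟙 (sym (dec-false (j ≟ i) (i≢j ∘ sym)))

  δ-disjoint : ∀ p {j k} → j ≢ k → δ p j + δ p k ≤ 1
  δ-disjoint p {j} {k} j≢k with p ≟ j | p ≟ k
  ... | yes refl | yes refl = contradiction refl j≢k
  ... | yes _    | no _     = s≤s z≤n
  ... | no _     | yes _    = s≤s z≤n
  ... | no _     | no _     = z≤n

  succᵇ : Fin n → Fin n → Bool
  succᵇ i j = toℕ j ≡ᵇ suc (toℕ i)

  succᵇ-sound : ∀ i j → succᵇ i j ≡ true → toℕ j ≡ suc (toℕ i)
  succᵇ-sound i j e = ℕP.≡ᵇ⇒≡ _ _ (true⇒T e)

  succᵇ-irr : ∀ i → succᵇ i i ≡ false
  succᵇ-irr i with succᵇ i i in e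
  ... | false = refl
  ... | true  = contradiction (sym (succᵇ-sound i i e)) ℕP.1+n≢n

  succᵇ-row : ∀ i → AtMostOne (succᵇ i)
  succᵇ-row i {j} {k} e e' = toℕ-injective (trans (succᵇ-sound i j e) (sym (succᵇ-sound i k e')))

  succᵇ-col : ∀ j → AtMostOne (λ i → succᵇ i j)
  succᵇ-col j {i} {k} e e' =
    toℕ-injective (ℕP.suc-injective (trans (sym (succᵇ-sound i j e)) (succᵇ-sound k j e')))

  module Matched (M : Matching n) where

    open Matching M

    multiplicity : Fin n → Fin n → ℕ
    multiplicity i j = ∑ pairs (λ p → δ (proj₁ p) i * δ (proj₂ p) j)

    -- The greedy choice may pair a period with itself. Such a pair is never violated, so discarding
    -- it preserves the violation count and keeps the graph loopless.
    matchedᵇ : Fin n → Fin n → Bool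
    matchedᵇ i j = not (does (i ≟ j)) ∧ (0 <ᵇ multiplicity i j)

    matchedᵇ-irr : ∀ i → matchedᵇ i i ≡ false
    matchedᵇ-irr i rewrite dec-true (i ≟ i) refl = refl

    matchedᵇ-positive : ∀ i j → matchedᵇ i j ≡ true → 1 ≤ multiplicity i j
    matchedᵇ-positive i j e =
      ℕP.<ᵇ⇒< 0 _ (true⇒T (proj₂ (∧-true (not (does (i ≟ j))) _ e)))

    source-≤-1 : ∀ i → ∑ pairs (λ p → δ (proj₁ p) i) ≤ 1
    source-≤-1 i = ℕP.≤-trans (sources (λ k → δ k i))
      (ℕP.≤-reflexive (trans (∑-cong ns λ k → δ-sym k i) (∑-δ i)))

    target-≤-1 : ∀ j → ∑ pairs (λ p → δ (proj₂ p) j) ≤ 1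
    target-≤-1 j = ℕP.≤-trans (targets (λ k → δ k j))
      (ℕP.≤-reflexive (trans (∑-cong ns λ k → δ-sym k j) (∑-δ j)))

    exclusive : ∀ {x y} → 1 ≤ x → 1 ≤ y → ¬ (x + y ≤ 1)
    exclusive 1≤x 1≤y x+y≤1 = ℕP.<⇒≱ (ℕP.+-mono-≤ 1≤x 1≤y) x+y≤1

    matchedᵇ-row : ∀ i → AtMostOne (matchedᵇ i)
    matchedᵇ-row i {j} {k} e e' with j ≟ k
    ... | yes j≡k = j≡k
    ... | no  j≢k = contradiction both
            (exclusive (matchedᵇ-positive i j e) (matchedᵇ-positive i k e'))
      where
      both : multiplicity i j + multiplicity i k ≤ 1
      both = begin
        multiplicity i j + multiplicity i k   ≡⟨ sym (∑-+ pairs _ _) ⟩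
        ∑ pairs (λ p → δ (proj₁ p) i * δ (proj₂ p) j + δ (proj₁ p) i * δ (proj₂ p) k)
          ≤⟨ ∑-mono pairs (λ p → ℕP.≤-trans
               (ℕP.≤-reflexive (sym (ℕP.*-distribˡ-+ (δ (proj₁ p) i) (δ (proj₂ p) j) (δ (proj₂ p) k))))
               (ℕP.≤-trans (ℕP.*-monoʳ-≤ (δ (proj₁ p) i) (δ-disjoint (proj₂ p) j≢k))
                 (ℕP.≤-reflexive (ℕP.*-identityʳ _)))) ⟩
        ∑ pairs (λ p → δ (proj₁ p) i)         ≤⟨ source-≤-1 i ⟩
        1                                     ∎
        where open ℕP.≤-Reasoning

    matchedᵇ-col : ∀ j → AtMostOne (λ i → matchedᵇ i j)
    matchedᵇ-col j {i} {k} e e' with i ≟ k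
    ... | yes i≡k = i≡k
    ... | no  i≢k = contradiction both
            (exclusive (matchedᵇ-positive i j e) (matchedᵇ-positive k j e'))
      where
      both : multiplicity i j + multiplicity k j ≤ 1
      both = begin
        multiplicity i j + multiplicity k j   ≡⟨ sym (∑-+ pairs _ _) ⟩
        ∑ pairs (λ p → δ (proj₁ p) i * δ (proj₂ p) j + δ (proj₁ p) k * δ (proj₂ p) j)
          ≤⟨ ∑-mono pairs (λ p → ℕP.≤-trans
               (ℕP.≤-reflexive (sym (ℕP.*-distribʳ-+ (δ (proj₂ p) j) (δ (proj₁ p) i) (δ (proj₁ p) k))))
               (ℕP.≤-trans (ℕP.*-monoˡ-≤ (δ (proj₂ p) j) (δ-disjoint (proj₁ p) i≢k))
                 (ℕP.≤-reflexive (ℕP.*-identityˡ _)))) ⟩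
        ∑ pairs (λ p → δ (proj₂ p) j)         ≤⟨ target-≤-1 j ⟩
        1                                     ∎
        where open ℕP.≤-Reasoning

    multiplicity-≤-1 : ∀ i j → multiplicity i j ≤ 1
    multiplicity-≤-1 i j = ℕP.≤-trans (∑-mono pairs λ p → ℕP.≤-trans
      (ℕP.*-monoʳ-≤ (δ (proj₁ p) i) (𝟙≤1 (does (proj₂ p ≟ j)))) (ℕP.≤-reflexive (ℕP.*-identityʳ _)))
      (source-≤-1 i)

    -- A list may repeat entries while a Boolean relation may not; multiplicity at most one, from
    -- the distinct sources, is what keeps the count.
    pairsViolated-≤ : ∀ (T : Spin n) →
      Weights.pairsViolated 255 pairs T ≤ ∑ ns λ i → ∑ ns λ j → 𝟙 (matchedᵇ i j ∧ (T i xor T j))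
    pairsViolated-≤ T = begin
      ∑ pairs (λ p → X (proj₁ p) (proj₂ p))
        ≡⟨ ∑-cong pairs (λ p → sym (trans
             (∑-cong ns λ i → trans (∑-*ˡ ns (δ (proj₁ p) i) _)
               (cong (δ (proj₁ p) i *_) (∑-δ-* (proj₂ p) (X i))))
             (∑-δ-* (proj₁ p) (λ i → X i (proj₂ p))))) ⟩
      ∑ pairs (λ p → ∑ ns λ i → ∑ ns λ j → δ (proj₁ p) i * (δ (proj₂ p) j * X i j))
        ≡⟨ trans (∑-swap pairs ns _) (∑-cong ns λ i → ∑-swap pairs ns _) ⟩
      ∑ ns (λ i → ∑ ns λ j → ∑ pairs λ p → δ (proj₁ p) i * (δ (proj₂ p) j * X i j))
        ≡⟨ ∑∑-cong ns ns (λ i j → trans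
             (∑-cong pairs λ p → sym (ℕP.*-assoc (δ (proj₁ p) i) (δ (proj₂ p) j) (X i j)))
             (∑-*ʳ pairs (X i j) _)) ⟩
      ∑ ns (λ i → ∑ ns λ j → multiplicity i j * X i j)
        ≤⟨ ∑-mono ns (λ i → ∑-mono ns λ j → pointwise i j) ⟩
      ∑ ns (λ i → ∑ ns λ j → 𝟙 (matchedᵇ i j ∧ (T i xor T j))) ∎
      where
      open ℕP.≤-Reasoning
      X : Fin n → Fin n → ℕ
      X i j = 𝟙 (T i xor T j)
      bit : ∀ m x → m ≤ 1 → m * 𝟙 x ≤ 𝟙 ((0 <ᵇ m) ∧ x)
      bit zero          x _ = z≤n
      bit (suc zero)    x _ = ℕP.≤-reflexive (ℕP.*-identityˡ (𝟙 x))
      bit (suc (suc m)) x (s≤s ())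
      pointwise : ∀ i j → multiplicity i j * X i j ≤ 𝟙 (matchedᵇ i j ∧ (T i xor T j))
      pointwise i j with i ≟ j
      ... | yes refl rewrite BoolP.xor-same (T i) = ℕP.≤-reflexive (ℕP.*-zeroʳ (multiplicity i i))
      ... | no _ = bit (multiplicity i j) (T i xor T j) (multiplicity-≤-1 i j)

pathViolated-≤ : ∀ {n} (T : Spin n) →
  Weights.pathViolated 255 T
    ≤ ∑ (allFin n) λ i → ∑ (allFin n) λ j → 𝟙 (succᵇ i j ∧ (T i xor T j))
pathViolated-≤ {zero}        T = z≤n
pathViolated-≤ {suc zero}    T = z≤n
pathViolated-≤ {suc (suc n)} T = begin
  F zero (suc zero) + Weights.pathViolated 255 (T ∘ suc)
    ≤⟨ ℕP.+-mono-≤ (ℕP.m≤m+n _ _) (pathViolated-≤ (T ∘ suc)) ⟩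
  (F zero (suc zero) + ∑ (allFin n) (λ j → F zero (suc (suc j))))
    + ∑ (allFin (suc n)) (λ i → ∑ (allFin (suc n)) λ j → F (suc i) (suc j))
    ≡⟨ sym (cong₂ _+_ (trans (∑-fin-suc (F zero)) (∑-fin-suc (λ j → F zero (suc j))))
         (∑-cong (allFin (suc n)) λ i → ∑-fin-suc (F (suc i)))) ⟩
  ∑ (allFin (suc (suc n))) (F zero) + ∑ (allFin (suc n)) (λ i → ∑ (allFin (suc (suc n))) (F (suc i)))
    ≡⟨ sym (∑-fin-suc (λ i → ∑ (allFin (suc (suc n))) (F i))) ⟩
  ∑ (allFin (suc (suc n))) (λ i → ∑ (allFin (suc (suc n))) (F i)) ∎
  where
  open ℕP.≤-Reasoning
  F : Fin (suc (suc n)) → Fin (suc (suc n)) → ℕ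
  F i j = 𝟙 (succᵇ i j ∧ (T i xor T j))

-- The mixing time

2ℚ : ℚ
2ℚ = 1ℚ ℚ.+ 1ℚ

^ℚ-+ : ∀ x a b → x ^ℚ (a + b) ≡ x ^ℚ a ℚ.* x ^ℚ b
^ℚ-+ x zero    b = sym (ℚP.*-identityˡ (x ^ℚ b))
^ℚ-+ x (suc a) b = trans (cong (x ℚ.*_) (^ℚ-+ x a b)) (sym (ℚP.*-assoc x (x ^ℚ a) (x ^ℚ b)))

^ℚ-* : ∀ x a b → (x ^ℚ a) ^ℚ b ≡ x ^ℚ (b * a)
^ℚ-* x a zero    = refl
^ℚ-* x a (suc b) = trans (cong ((x ^ℚ a) ℚ.*_) (^ℚ-* x a b)) (sym (^ℚ-+ x a (b * a)))

1≤^ℚ : ∀ {x} → 1ℚ ℚ.≤ x → ∀ k → 1ℚ ℚ.≤ x ^ℚ k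
1≤^ℚ 1≤x zero = ℚP.≤-refl
1≤^ℚ {x} 1≤x (suc k) = ℚP.≤-trans (1≤^ℚ 1≤x k) (subst (ℚ._≤ x ℚ.* x ^ℚ k) (ℚP.*-identityˡ (x ^ℚ k))
  (*-mono-≤-nonNeg (x ^ℚ k) (ℚP.<⇒≤ (^ℚ-pos (ℚP.<-≤-trans (ℚP.positive⁻¹ 1ℚ) 1≤x) k)) 1≤x))

1<^ℚ : ∀ {x} → 1ℚ ℚ.< x → ∀ k → 1ℚ ℚ.< x ^ℚ suc k
1<^ℚ {x} 1<x k = ℚP.<-≤-trans 1<x (subst₂ ℚ._≤_ (ℚP.*-identityˡ x) (ℚP.*-comm (x ^ℚ k) x)
  (*-mono-≤-nonNeg x (ℚP.<⇒≤ (ℚP.<-trans (ℚP.positive⁻¹ 1ℚ) 1<x)) (1≤^ℚ (ℚP.<⇒≤ 1<x) k)))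

^ℚ-mono : ∀ {x a b} → 1ℚ ℚ.≤ x → a ≤ b → x ^ℚ a ℚ.≤ x ^ℚ b
^ℚ-mono {x} {a} 1≤x a≤b with ℕP.m≤n⇒∃[o]m+o≡n a≤b
... | o , refl = subst₂ ℚ._≤_ (ℚP.*-identityˡ (x ^ℚ a))
  (trans (ℚP.*-comm (x ^ℚ o) (x ^ℚ a)) (sym (^ℚ-+ x a o)))
  (*-mono-≤-nonNeg (x ^ℚ a) (ℚP.<⇒≤ (^ℚ-pos (ℚP.<-≤-trans (ℚP.positive⁻¹ 1ℚ) 1≤x) a)) (1≤^ℚ 1≤x o))

½^*2^ : ∀ k → ½ ^ℚ k ℚ.* 2ℚ ^ℚ k ≡ 1ℚ
½^*2^ zero    = refl
½^*2^ (suc k) = trans (inter (½ ^ℚ k) (2ℚ ^ℚ k)) (½^*2^ k)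
  where
  inter : ∀ a b → (½ ℚ.* a) ℚ.* (2ℚ ℚ.* b) ≡ a ℚ.* b
  inter = solve 2 (λ a b → (con ½ :* a) :* (con 2ℚ :* b) := a :* b) refl
    where open +-*-Solver

½^+½^ : ∀ k → ½ ^ℚ suc k ℚ.+ ½ ^ℚ suc k ≡ ½ ^ℚ k
½^+½^ k = halves (½ ^ℚ k)
  where
  halves : ∀ x → ½ ℚ.* x ℚ.+ ½ ℚ.* x ≡ x
  halves = solve 1 (λ x → con ½ :* x :+ con ½ :* x := x) refl
    where open +-*-Solver

∑-spins-½^ : ∀ n e → ΣQ.∑ (allSpins n) (λ _ → ½ ^ℚ (n + e)) ≡ ½ ^ℚ e
∑-spins-½^ zero    e = ℚP.+-identityʳ (½ ^ℚ e)
∑-spins-½^ (suc n) e = begin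
  ΣQ.∑ (allSpins (suc n)) (λ _ → ½ ^ℚ (suc n + e))
    ≡⟨ ΣQ.∑-spins-suc {n} {λ _ → ½ ^ℚ (suc n + e)} (λ _ → refl) ⟩
  half ℚ.+ half
    ≡⟨ cong₂ ℚ._+_ half≡ half≡ ⟩
  ½ ^ℚ suc e ℚ.+ ½ ^ℚ suc e
    ≡⟨ ½^+½^ e ⟩
  ½ ^ℚ e ∎
  where
  open ≡-Reasoning
  half = ΣQ.∑ (allSpins n) (λ _ → ½ ^ℚ (suc n + e))
  half≡ : half ≡ ½ ^ℚ suc e
  half≡ = trans (cong (λ k → ΣQ.∑ (allSpins n) (λ _ → ½ ^ℚ k)) (sym (ℕP.+-suc n e))) (∑-spins-½^ n (suc e))

2^×½^ : ∀ n e → (2 ^ n) ×ℚ (½ ^ℚ (n + e)) ≡ ½ ^ℚ e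
2^×½^ zero    e = ℚP.+-identityʳ (½ ^ℚ e)
2^×½^ (suc n) e = begin
  (2 ^ n + (2 ^ n + 0)) ×ℚ x            ≡⟨ cong (λ k → (2 ^ n + k) ×ℚ x) (ℕP.+-identityʳ (2 ^ n)) ⟩
  (2 ^ n + 2 ^ n) ×ℚ x                  ≡⟨ ×ℚ-homo-+ x (2 ^ n) (2 ^ n) ⟩
  (2 ^ n) ×ℚ x ℚ.+ (2 ^ n) ×ℚ x         ≡⟨ cong₂ ℚ._+_ half≡ half≡ ⟩
  ½ ^ℚ suc e ℚ.+ ½ ^ℚ suc e             ≡⟨ ½^+½^ e ⟩
  ½ ^ℚ e                                ∎
  where
  open ≡-Reasoning
  x = ½ ^ℚ (suc n + e)
  half≡ : (2 ^ n) ×ℚ x ≡ ½ ^ℚ suc e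
  half≡ = trans (cong (λ k → (2 ^ n) ×ℚ (½ ^ℚ k)) (sym (ℕP.+-suc n e))) (2^×½^ n (suc e))

×ℚ-nonNeg : ∀ n {x} → 0ℚ ℚ.≤ x → 0ℚ ℚ.≤ n ×ℚ x
×ℚ-nonNeg zero    0≤x = ℚP.≤-refl
×ℚ-nonNeg (suc n) 0≤x = +-nonNeg 0≤x (×ℚ-nonNeg n 0≤x)

×ℚ-mono-< : ∀ {m n x} → 0ℚ ℚ.< x → m < n → m ×ℚ x ℚ.< n ×ℚ x
×ℚ-mono-< {zero}  {suc n} {x} 0<x m<n = ℚP.<-≤-trans 0<x (≤-0+ (×ℚ-nonNeg n (ℚP.<⇒≤ 0<x)))
×ℚ-mono-< {suc m} {suc n} {x} 0<x m<n = ℚP.+-monoʳ-< x (×ℚ-mono-< 0<x (ℕP.≤-pred m<n))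

module Network {n} (M : Matching n) where

  open Matched M
  open Periods succᵇ matchedᵇ succᵇ-irr matchedᵇ-irr
    succᵇ-row succᵇ-col matchedᵇ-row matchedᵇ-col public

  spins : Spin (18 * n) → Spin n
  spins σ i = period σ i (# 7)

  viol-≤ : ∀ σ → viol M (spins σ) ≤ violated (period σ)
  viol-≤ σ = ℕP.≤-trans (ℕP.+-mono-≤ (pathViolated-≤ (spins σ)) (pairsViolated-≤ (spins σ)))
    (ℕP.≤-reflexive (sym (trans
      (∑-cong (allFin n) λ i → ∑-+ (allFin n) (λ j → 𝟙 (succᵇ i j ∧ clash i j)) _)
      (∑-+ (allFin n) _ _))))
    where
    clash : Fin n → Fin n → Bool
    clash i j = spins σ i xor spins σ j

  gap : ∀ {σ q} → q ≤ viol M (spins σ) → cutSize G σ * 3 + q ≤ cutSize G groundState * 3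
  gap {σ} {q} q≤ = subst₂ (λ a b → a + q ≤ b) (ℕP.*-comm 3 (cutSize G σ)) (ℕP.*-comm 3 (cutSize G groundState))
    (ℕP.≤-trans (ℕP.+-monoʳ-≤ (3 * cutSize G σ) (ℕP.≤-trans q≤ (viol-≤ σ))) (energy-gap σ))

up-flip : ∀ m {n} (a : Fin m) (σ : Spin (m * n)) v →
  up (λ i → σ (combine a i)) ≤ suc (up (λ i → flip σ v (combine a i)))
up-flip m {n} a σ v = begin
  up (λ i → σ (combine a i))
    ≤⟨ ∑-mono (allFin n) pointwise ⟩
  ∑ (allFin n) (λ i → δ home i + 𝟙 (flip σ v (combine a i)))
    ≡⟨ trans (∑-+ (allFin n) _ _) (cong (_+ up (λ i → flip σ v (combine a i))) (∑-δ home)) ⟩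
  suc (up (λ i → flip σ v (combine a i))) ∎
  where
  open ℕP.≤-Reasoning
  home : Fin n
  home = proj₂ (remQuot {m} n v)
  pointwise : ∀ i → 𝟙 (σ (combine a i)) ≤ δ home i + 𝟙 (flip σ v (combine a i))
  pointwise i with combine a i ≟ v
  ... | no _ = ℕP.m≤n+m _ _
  ... | yes e rewrite dec-true (home ≟ i) (trans (cong (λ u → proj₂ (remQuot {m} n u)) (sym e))
                                              (cong proj₂ (remQuot-combine a i))) =
    ℕP.≤-trans (𝟙≤1 _) (ℕP.m≤m+n 1 _)

≤ᵇ-false : ∀ {m n} → (m ≤ᵇ n) ≡ false → n < m
≤ᵇ-false {m} {n} e = ℕP.≰⇒> λ m≤n → subst T e (ℕP.≤⇒≤ᵇ m≤n)

≤ᵇ-true : ∀ {m n} → m ≤ n → (m ≤ᵇ n) ≡ true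
≤ᵇ-true {m} {n} m≤n with m ≤ᵇ n in e
... | true  = refl
... | false = contradiction m≤n (ℕP.<⇒≱ (≤ᵇ-false e))

>⇒≤ᵇ-false : ∀ {m n} → n < m → (m ≤ᵇ n) ≡ false
>⇒≤ᵇ-false {m} {n} n<m with m ≤ᵇ n in e
... | false = refl
... | true  = contradiction n<m (ℕP.≤⇒≯ (≤ᵇ-sound e))

slow-mixing : ∀ {m} (M : Matching (suc m)) κ q →
  (∀ T → up T ≡ suc ⌊ suc m /2⌋ → q ≤ viol M T) → 18 * suc m + (suc m + 2) ≤ q * κ →
  MixingTimeAtLeast (Network.G M) ((2ℚ ^ℚ κ) ^ℚ 3) (2 ^ suc m)
slow-mixing {m} M κ q expands large = groundState , λ t mixed →
  ℕP.≮⇒≥ λ t<T → ℚP.<-irrefl refl (ℚP.≤-<-trans (mixed⇒quarter≤escape t mixed)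
    (subst (t ×ℚ ε ℚ.<_) T×ε (×ℚ-mono-< ε-pos t<T)))
  where
  n = suc m
  h = ⌊ n /2⌋
  open Network M
  ν μ : ℚ
  ν = 2ℚ ^ℚ κ
  -- `energy-gap` speaks of three times the cut size, so with this cube each violated link gains a
  -- whole factor `ν`.
  μ = ν ^ℚ 3
  1≤2 : 1ℚ ℚ.≤ 2ℚ
  1≤2 = ≤-0+ (ℚP.nonNegative⁻¹ 1ℚ)
  1≤ν : 1ℚ ℚ.≤ ν
  1≤ν = 1≤^ℚ 1≤2 κ
  0<μ : 0ℚ ℚ.< μ
  0<μ = ℚP.<-≤-trans (ℚP.positive⁻¹ 1ℚ) (1≤^ℚ 1≤ν 3)
  -- `18 * n` cancels the number of states in `ε`, `n` allows for `2 ^ n` steps, and 2 makes the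
  -- mass leaked by then exactly `quarter`.
  E = 18 * n + (n + 2)

  height : Spin (18 * n) → ℕ
  height σ = up (spins σ)

  V B : Spin (18 * n) → Bool
  V σ = height σ ≤ᵇ h
  B σ = height σ ≡ᵇ suc h

  V-ext : Extensional V
  V-ext {σ} {τ} e = cong (_≤ᵇ h) (up-ext {n} {spins σ} {spins τ} (λ i → e (combine {18} (# 7) i)))

  -- More than `⌊ n /2⌋` up spins leave at most `⌊ n /2⌋` down spins, for either parity of `n`; this
  -- is why `V` takes the level `h` and the boundary layer is `suc h`.
  V-not : ∀ σ → V σ ≡ false → V (not ∘ σ) ≡ true
  V-not σ Vσ = ≤ᵇ-true {height (not ∘ σ)} {h} (ℕP.+-cancelˡ-≤ (suc h) _ _ (ℕP.≤-trans
    (ℕP.+-monoˡ-≤ (height (not ∘ σ)) (≤ᵇ-false {height σ} {h} Vσ))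
    (ℕP.≤-trans (ℕP.≤-reflexive (up-not (spins σ))) (n≤1+2⌊n/2⌋ n))))

  entry : ∀ σ v → V σ ≡ false → B σ ≡ false → V (flip σ v) ≡ false
  entry σ v Vσ Bσ = >⇒≤ᵇ-false (ℕP.≤-pred (ℕP.≤-trans (ℕP.≤∧≢⇒< (≤ᵇ-false Vσ) off) (up-flip 18 (# 7) σ v)))
    where
    off : suc h ≢ height σ
    off e = subst T Bσ (ℕP.≡⇒≡ᵇ (height σ) (suc h) (sym e))

  height-ground : height groundState ≡ n
  height-ground = trans (up-ext (λ i → period-ground i (# 7))) (∑-fin-1 n)

  ground∉V : V groundState ≡ false
  ground∉V = >⇒≤ᵇ-false (subst (h <_) (sym height-ground) (ℕP.⌊n/2⌋<n m))

  thin : ∀ σ → B σ ≡ true → wt G μ σ ℚ.≤ ½ ^ℚ E ℚ.* wt G μ groundState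
  thin σ Bσ = begin
    wt G μ σ
      ≡⟨ sym (ℚP.*-identityˡ (wt G μ σ)) ⟩
    1ℚ ℚ.* wt G μ σ
      ≡⟨ cong (ℚ._* wt G μ σ) (sym (½^*2^ E)) ⟩
    ½ ^ℚ E ℚ.* 2ℚ ^ℚ E ℚ.* wt G μ σ
      ≡⟨ ℚP.*-assoc (½ ^ℚ E) (2ℚ ^ℚ E) (wt G μ σ) ⟩
    ½ ^ℚ E ℚ.* (2ℚ ^ℚ E ℚ.* wt G μ σ)
      ≤⟨ scale (*-mono-≤-nonNeg (wt G μ σ) (ℚP.<⇒≤ (^ℚ-pos 0<μ (cutSize G σ))) (^ℚ-mono 1≤2 large)) ⟩
    ½ ^ℚ E ℚ.* (2ℚ ^ℚ (q * κ) ℚ.* wt G μ σ)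
      ≡⟨ cong (½ ^ℚ E ℚ.*_) (cong₂ ℚ._*_ (sym (^ℚ-* 2ℚ κ q)) (^ℚ-* ν 3 (cutSize G σ))) ⟩
    ½ ^ℚ E ℚ.* (ν ^ℚ q ℚ.* ν ^ℚ (cutSize G σ * 3))
      ≡⟨ cong (½ ^ℚ E ℚ.*_) (trans (ℚP.*-comm (ν ^ℚ q) _) (sym (^ℚ-+ ν (cutSize G σ * 3) q))) ⟩
    ½ ^ℚ E ℚ.* ν ^ℚ (cutSize G σ * 3 + q)
      ≤⟨ scale (^ℚ-mono 1≤ν (gap {σ} (expands (spins σ)
           (ℕP.≡ᵇ⇒≡ _ _ (true⇒T Bσ))))) ⟩
    ½ ^ℚ E ℚ.* ν ^ℚ (cutSize G groundState * 3)
      ≡⟨ cong (½ ^ℚ E ℚ.*_) (sym (^ℚ-* ν 3 (cutSize G groundState))) ⟩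
    ½ ^ℚ E ℚ.* wt G μ groundState ∎
    where
    open ℚP.≤-Reasoning
    scale : ∀ {a b} → a ℚ.≤ b → ½ ^ℚ E ℚ.* a ℚ.≤ ½ ^ℚ E ℚ.* b
    scale = ℚP.*-monoˡ-≤-nonNeg (½ ^ℚ E) {{ℚ.nonNegative (ℚP.<⇒≤ (^ℚ-pos (ℚP.positive⁻¹ ½) E))}}

  open Glauber.Bottleneck G 0<μ V B V-ext V-not entry groundState ground∉V
    (½ ^ℚ E) (ℚP.<⇒≤ (^ℚ-pos (ℚP.positive⁻¹ ½) E)) thin

  ε≡ : ε ≡ ½ ^ℚ (n + 2)
  ε≡ = ∑-spins-½^ (18 * n) (n + 2)

  ε-pos : 0ℚ ℚ.< ε
  ε-pos = subst (0ℚ ℚ.<_) (sym ε≡) (^ℚ-pos (ℚP.positive⁻¹ ½) (n + 2))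

  T×ε : (2 ^ n) ×ℚ ε ≡ quarter
  T×ε = trans (cong ((2 ^ n) ×ℚ_) ε≡) (2^×½^ n 2)

-- For few periods the path alone still gives a quasi-line graph of small degree, and the lower
-- bound is claimed only for large `n`.
matching : ∀ n → Matching n
matching zero = noMatching zero
matching (suc m) with 3 ≤? m ℕ./ 176
... | yes 3≤q = proj₁ (expander (m ℕ./ 176) (m ℕ.% 176) (division m) (m%n<n m 176) 3≤q)
  where
  division : ∀ m → m ≡ 176 * (m ℕ./ 176) + m ℕ.% 176
  division m = trans (m≡m%n+[m/n]*n m 176) (trans (ℕP.+-comm (m ℕ.% 176) _)
    (cong (_+ m ℕ.% 176) (ℕP.*-comm (m ℕ./ 176) 176)))
... | no _ = noMatching (suc m)

matching-expands : ∀ m → 3 ≤ m ℕ./ 176 → ∀ T → up T ≡ suc ⌊ suc m /2⌋ → m ℕ./ 176 ≤ viol (matching (suc m)) T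
matching-expands m 3≤q T upT with 3 ≤? m ℕ./ 176
... | yes 3≤q' = proj₂ (expander (m ℕ./ 176) (m ℕ.% 176) _ (m%n<n m 176) 3≤q') T upT
... | no  3≰q  = contradiction 3≤q 3≰q

-- Each unit of `q` covers 176 periods at 19 bits each, that is 3344 bits. The surplus up to 7000,
-- taken at least three times, absorbs the remainder of the division and the constants.
exponent-bound : ∀ m → 3 ≤ m ℕ./ 176 → 18 * suc m + (suc m + 2) ≤ (m ℕ./ 176) * 7000
exponent-bound m 3≤q = begin
  18 * suc m + (suc m + 2)         ≡⟨ e₁ m ⟩
  19 * m + 21                      ≤⟨ ℕP.+-monoˡ-≤ 21 (ℕP.*-monoʳ-≤ 19 m≤) ⟩
  19 * (176 + q * 176) + 21        ≡⟨ e₂ q ⟩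
  q * 3344 + 3365                  ≤⟨ ℕP.+-monoʳ-≤ (q * 3344) (ℕP.≤-trans (ℕP.m≤m+n 3365 7603) (ℕP.*-monoˡ-≤ 3656 3≤q)) ⟩
  q * 3344 + q * 3656              ≡⟨ sym (ℕP.*-distribˡ-+ q 3344 3656) ⟩
  q * 7000                         ∎
  where
  open ℕP.≤-Reasoning
  q = m ℕ./ 176
  m≤ : m ≤ 176 + q * 176
  m≤ = ℕP.≤-trans (ℕP.≤-reflexive (m≡m%n+[m/n]*n m 176)) (ℕP.+-monoˡ-≤ (q * 176) (ℕP.<⇒≤ (m%n<n m 176)))
  e₁ : ∀ m → 18 * suc m + (suc m + 2) ≡ 19 * m + 21
  e₁ = solve-∀
  e₂ : ∀ q → 19 * (176 + q * 176) + 21 ≡ q * 3344 + 3365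
  e₂ = solve-∀

theorem4 : Σ ℚ λ μ → (1ℚ ℚ.< μ) ×
    Σ ((n : ℕ) → Graph (18 * n)) λ G →
    (∀ n → QuasiLine (G n))
    × (∀ n → MaxDegreeAtMost (G n) 8)
    × Σ ℚ λ c → (0ℚ ℚ.< c) × Σ ℕ λ N →
    ∀ n → N ≤ n → Σ ℕ λ T → MixingTimeAtLeast (G n) μ T
    × (c ℚ.* ((+ (2 ^ n)) / 1) ℚ.≤ (+ T) / 1)
theorem4 =
  (2ℚ ^ℚ 7000) ^ℚ 3 , 1<^ℚ (1<^ℚ 1<2 6999) 2 ,
  (λ n → Network.G (matching n)) ,
  (λ n → Network.quasiLine (matching n)) ,
  (λ n → Network.maxDegree (matching n)) ,
  -- `529 = 3 * 176 + 1` is the least number of periods for which the quotient of `m` by 176 reaches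
  -- 3.
  1ℚ , ℚP.positive⁻¹ 1ℚ , 529 , λ where
    (suc m) (s≤s 528≤m) → 2 ^ suc m ,
      slow-mixing (matching (suc m)) 7000 (m ℕ./ 176)
        (matching-expands m (/-monoˡ-≤ 176 528≤m)) (exponent-bound m (/-monoˡ-≤ 176 528≤m)) ,
      ℚP.≤-reflexive (ℚP.*-identityˡ ((+ (2 ^ suc m)) / 1))
  where
  1<2 : 1ℚ ℚ.< 2ℚ
  1<2 = ℚP.+-monoʳ-< 1ℚ (ℚP.positive⁻¹ 1ℚ)
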